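{- Let $k\ge 1$. Let $p_1,p_2$ be permutations of $\{1,\dots,k\}$ whose rightmost letter is $1$ (the least letter), such that $p_1$ avoids $1\text{ - }23$ and $p_2$ avoids $1\text{ - }32$. (Thus the complements $C(p_1),C(p_2)$ have $k$ as their rightmost letter, $C(p_1)$ avoids $3\text{ - }21$, and $C(p_2)$ avoids $3\text{ - }12$.) Then $$E^{p_1}_{1\text{ - }23}(x)=E^{C(p_1)}_{3\text{ - }21}(x)=E^{p_2}_{1\text{ - }32}(x)=E^{C(p_2)}_{3\text{ - }12}(x)=\begin{cases}\dfrac{e^{e^x}}{(k-1)!}\displaystyle\int_0^x t^{k-1}e^{ -e^t+t}\,dt,&\text{if }k\ge2,\\[2mm] e^{e^x-1},&\text{if }k=1.\end{cases}$$
   Context: For a permutation $abc$ of $\{1,2,3\}$, a permutation $\pi=\pi_1\cdots\pi_n$ of $\{1,\dots,n\}$ contains the generalized pattern $a\text{ - }bc$ if there are indices $i<j<n$ such that $\pi_i\pi_j\pi_{j+1}$ is order-isomorphic to $abc$ (the last two letters must be adjacent in $\pi$); otherwise it avoids it. A permutation $\pi$ begins with a pattern $p=p_1\cdots p_k$ if $n\ge k$ and $\pi_1\cdots\pi_k$ is order-isomorphic to $p$; by convention, the empty permutation is also regarded as beginning with the pattern $1$ (the case $k=1$). The complement $C(\sigma)$ of $\sigma=\sigma_1\cdots\sigma_m$ is $b_1\cdots b_m$ with $b_i=m+1-\sigma_i$. $E^p_q(x)=\sum_{n\ge0}N^p_q(n)\frac{x^n}{n!}$, where $N^p_q(n)$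 is the number of permutations of $\{1,\dots,n\}$ that avoid $q$ and begin with $p$. Identities are identities of power series in $x$. -}

module Defs where

open import Algebra.Bundles using (CommutativeRing)
open import Algebra.Bundles.Raw using (RawSemiring)
open import Algebra.Morphism.Structures using (IsRingHomomorphism; IsMonoidHomomorphism)
import Algebra.Definitions.RawMonoid as RawMonoidDefinitions
import Algebra.Definitions.RawSemiring as RawSemiringDefinitions
open import Data.Fin using (Fin; toℕ; opposite; _<_)
open import Data.Fin.Patterns using (0F; 1F; 2F)
open import Data.Fin.Properties using (all?; any?; _<?_; _≟_)
open import Data.Integer using (+_)
open import Data.List using (List; length; filter; allFin; cartesianProductWith)
open import Data.Nat using (ℕ; zero; suc; _∸_; _≤_; _!)
import Data.Nat.Properties as ℕ
open import Data.Nat.Properties using (_!≢0)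
open import Data.Product using (_×_; ∃-syntax; Σ-syntax; _,_)
open import Data.Rational using (ℚ; _/_; +-*-rawRing)
open import Data.Sum using (_⊎_)
open import Data.Vec using (Vec; []; _∷_; lookup; map; truncate)
import Data.Vec.Relation.Unary.AllPairs as AllPairs
open import Data.Vec.Relation.Unary.Unique.Propositional using (Unique)
open import Function using (_⇔_; mk⇔; Equivalence)
open import Level using (Level; _⊔_) renaming (suc to lsuc)
open import Relation.Binary.PropositionalEquality using (_≡_)
open import Relation.Nullary using (¬_; Dec; yes; no)
open import Relation.Nullary.Decidable using (¬?; _×-dec_; _⊎-dec_; _→-dec_; map′)

-- Permutations are in one-line notation, the letter i of {1,…,n} being the
-- element i - 1 of Fin n.

IsPermutation : ∀ {n} → Vec (Fin n) n → Set
IsPermutation π = Unique π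

complement : ∀ {n} → Vec (Fin n) n → Vec (Fin n) n
complement = map opposite

OrderIsomorphic : ∀ {l m n} → Vec (Fin m) l → Vec (Fin n) l → Set
OrderIsomorphic u v = ∀ i j → (lookup u i < lookup u j) ⇔ (lookup v i < lookup v j)

-- `π Contains abc` is containment of the generalized pattern a-bc.

_Contains_ : ∀ {n} → Vec (Fin n) n → Vec (Fin 3) 3 → Set
π Contains abc = ∃[ i ] ∃[ j ] ∃[ j⁺ ]
  i < j × toℕ j⁺ ≡ suc (toℕ j) ×
  OrderIsomorphic (lookup π i ∷ lookup π j ∷ lookup π j⁺ ∷ []) abc

_Avoids_ : ∀ {n} → Vec (Fin n) n → Vec (Fin 3) 3 → Set
π Avoids abc = ¬ (π Contains abc)

_BeginsWith_ : ∀ {n k} → Vec (Fin n) n → Vec (Fin k) k → Set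
_BeginsWith_ {n} {k} π p =
  (Σ[ k≤n ∈ k ≤ n ] OrderIsomorphic (truncate k≤n π) p) ⊎
  (n ≡ 0 × k ≡ 1)

1-23 1-32 3-21 3-12 : Vec (Fin 3) 3
1-23 = 0F ∷ 1F ∷ 2F ∷ []
1-32 = 0F ∷ 2F ∷ 1F ∷ []
3-21 = 2F ∷ 1F ∷ 0F ∷ []
3-12 = 2F ∷ 0F ∷ 1F ∷ []

isPermutation? : ∀ {n} (π : Vec (Fin n) n) → Dec (IsPermutation π)
isPermutation? = AllPairs.allPairs? (λ x y → ¬? (x ≟ y))

orderIsomorphic? : ∀ {l m n} (u : Vec (Fin m) l) (v : Vec (Fin n) l) → Dec (OrderIsomorphic u v)
orderIsomorphic? u v = all? λ i → all? λ j →
  let u? = lookup u i <? lookup u j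
      v? = lookup v i <? lookup v j
  in map′ (λ (f , g) → mk⇔ f g) (λ e → Equivalence.to e , Equivalence.from e)
          ((u? →-dec v?) ×-dec (v? →-dec u?))

contains? : ∀ {n} (π : Vec (Fin n) n) abc → Dec (π Contains abc)
contains? π abc = any? λ i → any? λ j → any? λ j⁺ →
  i <? j ×-dec toℕ j⁺ ℕ.≟ suc (toℕ j) ×-dec
  orderIsomorphic? (lookup π i ∷ lookup π j ∷ lookup π j⁺ ∷ []) abc

beginsWith? : ∀ {n k} (π : Vec (Fin n) n) (p : Vec (Fin k) k) → Dec (π BeginsWith p)
beginsWith? {n} {k} π p = prefix? ⊎-dec (n ℕ.≟ 0 ×-dec k ℕ.≟ 1)
  where
  prefix? : Dec (Σ[ k≤n ∈ k ≤ n ] OrderIsomorphic (truncate k≤n π) p)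
  prefix? with k ℕ.≤? n
  ... | no  k≰n = no λ (k≤n , _) → k≰n k≤n
  ... | yes k≤n = map′ (k≤n ,_) irrelevant (orderIsomorphic? (truncate k≤n π) p)
    where
    irrelevant : (Σ[ k≤n′ ∈ k ≤ n ] OrderIsomorphic (truncate k≤n′ π) p) →
                 OrderIsomorphic (truncate k≤n π) p
    irrelevant (k≤n′ , iso) rewrite ℕ.≤-irrelevant k≤n k≤n′ = iso

words : ∀ m n → List (Vec (Fin m) n)
words m zero    = [] List.∷ List.[]
words m (suc n) = cartesianProductWith _∷_ (allFin m) (words m n)

N : ∀ {k} → Vec (Fin k) k → Vec (Fin 3) 3 → ℕ → ℕ
N p q n = length (filter
  (λ π → isPermutation? π ×-dec ¬? (contains? π q) ×-dec beginsWith? π p)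
  (words n n))

-- The constants e and e⁻¹ in e^(e^x) and e^(-e^t+t) are not rational, so the
-- coefficients are taken in a commutative ring containing an image of ℚ and
-- equipped with an exponential map from (K, +) to (K, *).  The intended instance
-- is ℝ with its usual exponential; ℚ with the constant map 1 is another.

record ExponentialℚAlgebra (c ℓ : Level) : Set (lsuc (c ⊔ ℓ)) where
  field
    commutativeRing : CommutativeRing c ℓ
  open CommutativeRing commutativeRing public
  field
    fromℚ          : ℚ → Carrier
    fromℚ-homo     : IsRingHomomorphism +-*-rawRing rawRing fromℚ
    expScalar      : Carrier → Carrier
    expScalar-homo : IsMonoidHomomorphism +-rawMonoid *-rawMonoid expScalar

module PowerSeries {c ℓ} (K : ExponentialℚAlgebra c ℓ) where
  private module K = ExponentialℚAlgebra K
  open K using (Carrier; fromℚ; expScalar)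
  open RawMonoidDefinitions K.+-rawMonoid using (sum)

  infix  4 _≋_
  infixl 6 _+_ _-_
  infixl 7 _*_
  infix  8 -_

  -- f n is the coefficient of xⁿ.
  Series : Set c
  Series = ℕ → Carrier

  _≋_ : Series → Series → Set ℓ
  f ≋ g = ∀ n → f n K.≈ g n

  const : Carrier → Series
  const a zero    = a
  const a (suc _) = K.0#

  X : Series
  X 1 = K.1#
  X _ = K.0#

  _+_ : Series → Series → Series
  (f + g) n = f n K.+ g n

  -_ : Series → Series
  (- f) n = K.- f n

  _-_ : Series → Series → Series
  f - g = f + (- g)

  _*_ : Series → Series → Series
  (f * g) n = sum {suc n} λ i → f (toℕ i) K.* g (n ∸ toℕ i)

  rawSemiring : RawSemiring c ℓ
  rawSemiring = record
    { Carrier = Series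
    ; _≈_     = _≋_
    ; _+_     = _+_
    ; _*_     = _*_
    ; 0#      = const K.0#
    ; 1#      = const K.1#
    }

  open RawSemiringDefinitions rawSemiring public using (_^_)

  1/_! : ℕ → Carrier
  1/ n ! = fromℚ (_/_ (+ 1) (n !) {{n !≢0}})

  ∫ : Series → Series
  ∫ f zero    = K.0#
  ∫ f (suc n) = fromℚ (+ 1 / suc n) K.* f n

  -- exp f = e^(f₀) Σⱼ (f - f₀)ʲ / j! where f₀ is the constant term; as (f - f₀)ʲ
  -- is divisible by xʲ, only j ≤ n contribute to the coefficient of xⁿ.
  exp : Series → Series
  exp f n = expScalar (f 0) K.*
    sum {suc n} λ j → 1/ toℕ j ! K.* ((f - const (f 0)) ^ toℕ j) n

  E : ∀ {k} → Vec (Fin k) k → Vec (Fin 3) 3 → Series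
  E p q n = fromℚ (_/_ (+ N p q n) (n !) {{n !≢0}})

  -- Meaningful for k ≥ 1 only.
  closedForm : ℕ → Series
  closedForm 1 = exp (exp X - const K.1#)
  closedForm k = exp (exp X) * const (1/ (k ∸ 1) !) *
                 ∫ (X ^ (k ∸ 1) * exp (- exp X + X))

{-# OPTIONS --safe #-}
module Submission where

-- A permutation avoids 1-23 (1-32) if and only if it is σ 1 τ with τ decreasing (increasing) and σ
-- avoiding the pattern, since every ascent (descent) after the letter 1 forms the pattern with it.
-- If moreover the permutation begins with a word p = p′ 1 of length k, then either σ begins with p
-- or σ is order-isomorphic to p′.  Choosing the letters of σ gives
--   N(n+1) = Σⱼ C(n,j) (N(j) + [j = k-1]),
-- that is E′ = eˣ (E + xᵏ⁻¹/(k-1)!), except that for k = 1 the convention on the empty permutation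
-- makes it E′ = eˣ E.  The closed form is the solution of this differential equation, whose
-- coefficients are determined recursively by the first one.

open import Defs
open import Algebra.Bundles using (CommutativeRing)
open import Algebra.Morphism.Structures using (IsRingHomomorphism; IsMonoidHomomorphism)
open import Data.Fin as Fin using (Fin; zero; suc; toℕ; inject₁; opposite; fromℕ)
open import Data.Fin.Patterns using (0F; 1F; 2F)
import Data.Fin.Properties as Fin
open import Data.Integer as ℤ using (+_)
import Data.Integer.Properties as ℤ
open import Data.List as List using (List; []; _∷_; _++_; length; allFin)
import Data.List.Properties as List
open import Data.List.Membership.Propositional using (_∈_)
import Data.List.Membership.Propositional.Properties as ∈
import Data.List.Membership.Propositional.Properties.WithK as ∈
open import Data.List.Relation.Binary.BagAndSetEquality using (∼bag⇒↭)
open import Data.List.Relation.Binary.Permutation.Propositional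
  using (_↭_; ↭-refl; ↭-sym; ↭-trans; ↭-prep; ↭-reflexive; ↭⇒↭ₛ)
import Data.List.Relation.Binary.Permutation.Propositional.Properties as ↭
import Data.List.Relation.Binary.Permutation.Setoid.Properties as ↭ₛ
open import Data.List.Relation.Binary.Pointwise using (Pointwise-≡⇒≡)
open import Data.List.Relation.Ternary.Interleaving.Propositional
  using (Interleaving; []; consˡ; consʳ; toPermutation)
open import Data.List.Relation.Unary.All as All using (All; []; _∷_)
import Data.List.Relation.Unary.All.Properties as All
open import Data.List.Relation.Unary.AllPairs as AllPairs using (AllPairs; []; _∷_)
import Data.List.Relation.Unary.AllPairs.Properties as AllPairs
open import Data.List.Relation.Unary.Any using (here; there)
open import Data.List.Relation.Unary.Linked as Linked using (Linked; []; [-]; _∷_)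
import Data.List.Relation.Unary.Sorted.TotalOrder.Properties as Sorting
open import Data.List.Relation.Unary.Unique.Propositional using (Unique)
import Data.List.Relation.Unary.Unique.Propositional.Properties as Unique
import Data.List.Sort as Sort
open import Data.Nat as ℕ using (ℕ; zero; suc; _<_; _≤_; _∸_; _!; s≤s; z≤n)
import Data.Nat.Properties as ℕ
open import Data.Product using (_×_; _,_; proj₁; proj₂; ∃-syntax)
open import Data.Rational as ℚ using (_/_)
import Data.Rational.Properties as ℚ
open import Data.Rational.Unnormalised as ℚᵘ using (mkℚᵘ; *≡*)
import Data.Rational.Unnormalised.Properties as ℚᵘ
open import Data.Sum using (_⊎_; inj₁; inj₂; [_,_])
open import Data.Unit using (⊤; tt)
open import Data.Vec as Vec using (Vec; []; _∷_; lookup; toList; truncate; last)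
import Data.Vec.Properties as Vec
open import Data.Vec.Relation.Unary.All as VecAll using ([]; _∷_)
open import Data.Vec.Relation.Unary.AllPairs as VecAllPairs using ([]; _∷_)
import Data.Vec.Relation.Unary.Unique.Propositional as VecUnique
import Data.Vec.Relation.Unary.Unique.Propositional.Properties as VecUnique
open import Function using (_∘_; _⇔_; mk⇔; Equivalence)
open import Level using (0ℓ)
import Relation.Binary.Construct.Flip.EqAndOrd as Flip
open import Relation.Binary.Bundles using (DecTotalOrder)
open import Relation.Binary.PropositionalEquality hiding ([_])
open import Relation.Binary.Structures using (IsDecTotalOrder)
open import Relation.Nullary using (¬_; yes; no; contradiction)
open import Relation.Nullary.Decidable using (¬?; _×-dec_; decidable-stable)

-- Power series

-- The word σ before the least letter need not be a permutation of an initial segment. Instead of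
-- standardizing it, the count is made for words over an arbitrary increasing list of natural
-- numbers; the result depends only on the length of that list. One argument serves 1-23 and 1-32:
-- the order imposed on adjacent letters is a parameter, later taken to be ≥ and ≤. The patterns
-- 3-21 and 3-12 follow by complementation.
--
-- On the side of series, an equation y′ = h y + r has at most one solution with a given constant
-- term because the image of ℚ in K makes every n + 1 invertible. The same uniqueness gives e^(e^x)
-- · e^(-e^x + x) = e^x, so no general addition theorem for `exp` is required.
--
-- The empty permutation is kept apart. The combinatorial count is compared with `N` at positive
-- lengths only, and the convention for k = 1 enters through the constant term.

/-≡ : ∀ a b m n .{{_ : ℕ.NonZero m}} .{{_ : ℕ.NonZero n}} →
      a ℕ.* n ≡ b ℕ.* m → + a / m ≡ + b / n
/-≡ a b (suc m) (suc n) eq = ℚ.fromℚᵘ-cong {mkℚᵘ (+ a) m} {mkℚᵘ (+ b) n}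
  (*≡* (trans (sym (ℤ.pos-* a (suc n))) (trans (cong +_ eq) (ℤ.pos-* b (suc m)))))

-- `_/_` reduces to lowest terms, so the identity is checked on unnormalised fractions. The
-- denominator `o` is a separate variable so that a product such as `1 * n !` can be presented as
-- `n !`.
/-* : ∀ a b m n o .{{_ : ℕ.NonZero m}} .{{_ : ℕ.NonZero n}} .{{_ : ℕ.NonZero o}} →
      m ℕ.* n ≡ o → (+ a / m) ℚ.* (+ b / n) ≡ + (a ℕ.* b) / o
/-* a b (suc m) (suc n) o refl = ℚ.toℚᵘ-injective (begin
  ℚ.toℚᵘ ((+ a / suc m) ℚ.* (+ b / suc n))        ≈⟨ ℚ.toℚᵘ-homo-* (+ a / suc m) (+ b / suc n) ⟩
  ℚ.toℚᵘ (+ a / suc m) ℚᵘ.* ℚ.toℚᵘ (+ b / suc n)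
    ≈⟨ ℚᵘ.*-cong (ℚ.toℚᵘ-fromℚᵘ (mkℚᵘ (+ a) m)) (ℚ.toℚᵘ-fromℚᵘ (mkℚᵘ (+ b) n)) ⟩
  mkℚᵘ (+ a) m ℚᵘ.* mkℚᵘ (+ b) n                  ≡⟨ cong (λ i → mkℚᵘ i (n ℕ.+ m ℕ.* suc n)) (sym (ℤ.pos-* a b)) ⟩
  mkℚᵘ (+ (a ℕ.* b)) (n ℕ.+ m ℕ.* suc n)          ≈⟨ ℚ.toℚᵘ-fromℚᵘ (mkℚᵘ (+ (a ℕ.* b)) (n ℕ.+ m ℕ.* suc n)) ⟨
  ℚ.toℚᵘ (+ (a ℕ.* b) / (suc m ℕ.* suc n))        ∎)
  where open ℚᵘ.≃-Reasoning

/1-+ : ∀ a b → + (a ℕ.+ b) / 1 ≡ (+ a / 1) ℚ.+ (+ b / 1)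
/1-+ a b = ℚ.toℚᵘ-injective (begin
  ℚ.toℚᵘ (+ (a ℕ.+ b) / 1)                ≈⟨ ℚ.toℚᵘ-fromℚᵘ (mkℚᵘ (+ (a ℕ.+ b)) 0) ⟩
  mkℚᵘ (+ (a ℕ.+ b)) 0
    ≡⟨ cong₂ (λ i j → mkℚᵘ (i ℤ.+ j) 0) (sym (ℤ.*-identityʳ (+ a))) (sym (ℤ.*-identityʳ (+ b))) ⟩
  mkℚᵘ (+ a) 0 ℚᵘ.+ mkℚᵘ (+ b) 0
    ≈⟨ ℚᵘ.+-cong (ℚ.toℚᵘ-fromℚᵘ (mkℚᵘ (+ a) 0)) (ℚ.toℚᵘ-fromℚᵘ (mkℚᵘ (+ b) 0)) ⟨
  ℚ.toℚᵘ (+ a / 1) ℚᵘ.+ ℚ.toℚᵘ (+ b / 1)  ≈⟨ ℚ.toℚᵘ-homo-+ (+ a / 1) (+ b / 1) ⟨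
  ℚ.toℚᵘ ((+ a / 1) ℚ.+ (+ b / 1))        ∎)
  where open ℚᵘ.≃-Reasoning

-- binomialTransform f n = Σⱼ C(n,j) f(j), by Pascal's rule.
binomialTransform : (ℕ → ℕ) → ℕ → ℕ
binomialTransform f zero    = f 0
binomialTransform f (suc n) = binomialTransform f n ℕ.+ binomialTransform (f ∘ suc) n

δ : ℕ → ℕ → ℕ
δ zero    zero    = 1
δ (suc d) (suc n) = δ d n
δ _       _       = 0

δ-diagonal : ∀ d → δ d d ≡ 1
δ-diagonal zero    = refl
δ-diagonal (suc d) = δ-diagonal d

δ-offDiagonal : ∀ {d n} → d ≢ n → δ d n ≡ 0
δ-offDiagonal {zero}  {zero}  d≢n = contradiction refl d≢n
δ-offDiagonal {zero}  {suc n} _   = refl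
δ-offDiagonal {suc d} {zero}  _   = refl
δ-offDiagonal {suc d} {suc n} d≢n = δ-offDiagonal (d≢n ∘ cong suc)

module SeriesProperties {c ℓ} (K : ExponentialℚAlgebra c ℓ) where
  private module K = ExponentialℚAlgebra K
  open K using (Carrier; fromℚ; expScalar)
  open PowerSeries K
  private
    module ι = IsRingHomomorphism K.fromℚ-homo
    module e = IsMonoidHomomorphism K.expScalar-homo
  open import Algebra.Properties.Semiring.Sum K.semiring using (sum; sum-cong-≋; sum-init-last; *-distribˡ-sum)
  open import Algebra.Properties.CommutativeMonoid.Sum K.+-commutativeMonoid using (∑-distrib-+)
  open import Relation.Binary.Reasoning.Setoid K.setoid
  open import Algebra.Solver.Ring.NaturalCoefficients.Default K.commutativeSemiring
    using (solve; _:=_; _:+_; _:*_; con)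

  infix 4 _≈_
  infixl 6 _⊕_
  infixl 7 _·_
  _≈_ = K._≈_
  _·_ = K._*_
  _⊕_ = K._+_

  -- Since shift (f * g) = f₀ · shift g + shift f * g holds by computation, the ring laws follow by
  -- induction on the coefficient.
  shift : Series → Series
  shift f n = f (suc n)

  -- The bound on m matters wherever two factors agree only up to some degree, as truncations of an
  -- exponential do.
  *-local : ∀ n {f f′ g g′} → (∀ {m} → m ℕ.≤ n → f m ≈ f′ m) → (∀ {m} → m ℕ.≤ n → g m ≈ g′ m) →
            (f * g) n ≈ (f′ * g′) n
  *-local n f≈f′ g≈g′ = sum-cong-≋ λ (i : Fin (suc n)) →
    K.*-cong (f≈f′ (ℕ.≤-pred (Fin.toℕ<n i))) (g≈g′ (ℕ.m∸n≤m n (toℕ i)))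

  *-congˡ : ∀ f {g g′} → g ≋ g′ → f * g ≋ f * g′
  *-congˡ f g≋g′ n = *-local n (λ {m} _ → K.refl {f m}) (λ {m} _ → g≋g′ m)

  *-congʳ : ∀ g {f f′} → f ≋ f′ → f * g ≋ f′ * g
  *-congʳ g f≋f′ n = *-local n (λ {m} _ → f≋f′ m) (λ {m} _ → K.refl {g m})

  *-localˡ : ∀ f n {g g′} → (∀ {m} → m ℕ.≤ n → g m ≈ g′ m) → (f * g) n ≈ (f * g′) n
  *-localˡ f n g≈g′ = sum-cong-≋ λ (i : Fin (suc n)) → K.*-congˡ {f (toℕ i)} (g≈g′ (ℕ.m∸n≤m n (toℕ i)))

  *-zeroˡ : ∀ {z} g → (∀ n → z n ≈ K.0#) → ∀ n → (z * g) n ≈ K.0#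
  *-zeroˡ g z≈0 zero    = K.trans (K.+-identityʳ _) (K.trans (K.*-congʳ (z≈0 0)) (K.zeroˡ _))
  *-zeroˡ g z≈0 (suc n) =
    K.trans (K.+-cong (K.trans (K.*-congʳ (z≈0 0)) (K.zeroˡ _)) (*-zeroˡ g (z≈0 ∘ suc) n)) (K.+-identityˡ _)

  const-0 : ∀ n → const K.0# n ≈ K.0#
  const-0 zero    = K.refl
  const-0 (suc n) = K.refl

  const-* : ∀ a f n → (const a * f) n ≈ a · f n
  const-* a f zero    = K.+-identityʳ _
  const-* a f (suc n) = K.trans (K.+-congˡ (*-zeroˡ f (λ _ → K.refl) n)) (K.+-identityʳ _)

  *-distribʳ : ∀ h f g → (f + g) * h ≋ f * h + g * h
  *-distribʳ h f g zero    =
    solve 3 (λ x y z → (x :+ y) :* z :+ con 0 := (x :* z :+ con 0) :+ (y :* z :+ con 0)) K.refl (f 0) (g 0) (h 0)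
  *-distribʳ h f g (suc n) = begin
    (f 0 ⊕ g 0) · h (suc n) ⊕ ((shift f + shift g) * h) n
      ≈⟨ K.+-congˡ (*-distribʳ h (shift f) (shift g) n) ⟩
    (f 0 ⊕ g 0) · h (suc n) ⊕ ((shift f * h) n ⊕ (shift g * h) n)
      ≈⟨ solve 5 (λ x y z u v → (x :+ y) :* z :+ (u :+ v) := (x :* z :+ u) :+ (y :* z :+ v)) K.refl
               (f 0) (g 0) (h (suc n)) ((shift f * h) n) ((shift g * h) n) ⟩
    (f * h) (suc n) ⊕ (g * h) (suc n) ∎

  scale-* : ∀ a f g n → ((λ m → a · f m) * g) n ≈ a · (f * g) n
  scale-* a f g n = begin
    ((λ m → a · f m) * g) n                       ≈⟨ sum-cong-≋ (λ (i : Fin (suc n)) → K.*-assoc a (f (toℕ i)) (g (n ∸ toℕ i))) ⟩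
    sum (λ (i : Fin (suc n)) → a · (f (toℕ i) · g (n ∸ toℕ i))) ≈⟨ *-distribˡ-sum a (λ (i : Fin (suc n)) → f (toℕ i) · g (n ∸ toℕ i)) ⟨
    a · (f * g) n                                 ∎

  *-assoc : ∀ f g h → (f * g) * h ≋ f * (g * h)
  *-assoc f g h zero    =
    solve 3 (λ x y z → (x :* y :+ con 0) :* z :+ con 0 := x :* (y :* z :+ con 0) :+ con 0) K.refl (f 0) (g 0) (h 0)
  *-assoc f g h (suc n) = begin
    (f 0 · g 0 ⊕ K.0#) · h (suc n) ⊕ (((λ m → f 0 · g (suc m)) + shift f * g) * h) n
      ≈⟨ K.+-congˡ (*-distribʳ h (λ m → f 0 · g (suc m)) (shift f * g) n) ⟩
    (f 0 · g 0 ⊕ K.0#) · h (suc n) ⊕ (((λ m → f 0 · g (suc m)) * h) n ⊕ ((shift f * g) * h) n)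
      ≈⟨ K.+-congˡ (K.+-cong (scale-* (f 0) (shift g) h n) (*-assoc (shift f) g h n)) ⟩
    (f 0 · g 0 ⊕ K.0#) · h (suc n) ⊕ (f 0 · (shift g * h) n ⊕ (shift f * (g * h)) n)
      ≈⟨ solve 5 (λ x y z u v → (x :* y :+ con 0) :* z :+ (x :* u :+ v) := x :* (y :* z :+ u) :+ v) K.refl
               (f 0) (g 0) (h (suc n)) ((shift g * h) n) ((shift f * (g * h)) n) ⟩
    f 0 · (g 0 · h (suc n) ⊕ (shift g * h) n) ⊕ (shift f * (g * h)) n ∎

  -- Peeling a coefficient off one factor leaves `shift f * g`, which is no longer symmetric. Both
  -- sides are therefore peeled twice, down to `shift f * shift g`; hence the two base cases.
  *-comm : ∀ f g → f * g ≋ g * f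
  *-comm f g zero          = K.+-congʳ (K.*-comm _ _)
  *-comm f g (suc zero)    =
    solve 4 (λ x x′ y y′ → x :* y′ :+ (x′ :* y :+ con 0) := y :* x′ :+ (y′ :* x :+ con 0)) K.refl (f 0) (f 1) (g 0) (g 1)
  *-comm f g (suc (suc n)) = begin
    f 0 · g (2 ℕ.+ n) ⊕ (shift f * g) (suc n)
      ≈⟨ K.+-congˡ (*-comm (shift f) g (suc n)) ⟩
    f 0 · g (2 ℕ.+ n) ⊕ (g 0 · f (2 ℕ.+ n) ⊕ (shift g * shift f) n)
      ≈⟨ K.+-congˡ (K.+-congˡ (*-comm (shift g) (shift f) n)) ⟩
    f 0 · g (2 ℕ.+ n) ⊕ (g 0 · f (2 ℕ.+ n) ⊕ (shift f * shift g) n)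
      ≈⟨ solve 3 (λ x y z → x :+ (y :+ z) := y :+ (x :+ z)) K.refl (f 0 · g (2 ℕ.+ n)) (g 0 · f (2 ℕ.+ n)) _ ⟩
    g 0 · f (2 ℕ.+ n) ⊕ (f 0 · g (2 ℕ.+ n) ⊕ (shift f * shift g) n)
      ≈⟨ K.+-congˡ (*-comm (shift g) f (suc n)) ⟨
    g 0 · f (2 ℕ.+ n) ⊕ (shift g * f) (suc n) ∎

  seriesRing : CommutativeRing c ℓ
  seriesRing = record
    { Carrier = Series
    ; _≈_ = _≋_
    ; _+_ = _+_
    ; _*_ = _*_
    ; -_  = -_
    ; 0#  = const K.0#
    ; 1#  = const K.1#
    ; isCommutativeRing = record
      { isRing = record
        { +-isAbelianGroup = record
          { isGroup = record
            { isMonoid = record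
              { isSemigroup = record
                { isMagma = record
                  { isEquivalence = record
                    { refl  = λ _ → K.refl
                    ; sym   = λ p n → K.sym (p n)
                    ; trans = λ p q n → K.trans (p n) (q n)
                    }
                  ; ∙-cong = λ p q n → K.+-cong (p n) (q n)
                  }
                ; assoc = λ f g h n → K.+-assoc (f n) (g n) (h n)
                }
              ; identity = +-idˡ , λ f n → K.trans (K.+-comm _ _) (+-idˡ f n)
              }
            ; inverse = -‿invˡ , λ f n → K.trans (K.+-comm _ _) (-‿invˡ f n)
            ; ⁻¹-cong = λ p n → K.-‿cong (p n)
            }
          ; comm = λ f g n → K.+-comm (f n) (g n)
          }
        ; *-cong = λ p q n → *-local n (λ {m} _ → p m) (λ {m} _ → q m)
        ; *-assoc = *-assoc
        ; *-identity = *-idˡ , λ f n → K.trans (*-comm f (const K.1#) n) (*-idˡ f n)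
        ; distrib = (λ f g h n → K.trans (*-comm f (g + h) n) (K.trans (*-distribʳ f g h n)
                                   (K.+-cong (*-comm g f n) (*-comm h f n))))
                  , *-distribʳ
        }
      ; *-comm = *-comm
      }
    }
    where
    +-idˡ : ∀ f → const K.0# + f ≋ f
    +-idˡ f n = K.trans (K.+-congʳ (const-0 n)) (K.+-identityˡ _)
    -‿invˡ : ∀ f → - f + f ≋ const K.0#
    -‿invˡ f n = K.trans (K.-‿inverseˡ (f n)) (K.sym (const-0 n))
    *-idˡ : ∀ f → const K.1# * f ≋ f
    *-idˡ f n = K.trans (const-* K.1# f n) (K.*-identityˡ _)

  private module S = CommutativeRing seriesRing
  open import Algebra.Solver.Ring.NaturalCoefficients.Default S.commutativeSemiring
    using () renaming (solve to solveₛ; _:=_ to _:=ₛ_; _:+_ to _:+ₛ_; _:*_ to _:*ₛ_; con to conₛ)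

  infixr 2 step-≋ step-≋˘
  infix  3 _∎ₛ

  step-≋ : ∀ f {g h} → g ≋ h → f ≋ g → f ≋ h
  step-≋ f g≋h f≋g = S.trans f≋g g≋h
  syntax step-≋ f g≋h f≋g = f ≋⟨ f≋g ⟩ g≋h

  step-≋˘ : ∀ f {g h} → g ≋ h → g ≋ f → f ≋ h
  step-≋˘ f g≋h g≋f = S.trans (S.sym g≋f) g≋h
  syntax step-≋˘ f g≋h g≋f = f ≋˘⟨ g≋f ⟩ g≋h

  _∎ₛ : ∀ f → f ≋ f
  f ∎ₛ = S.refl

  ⟦_⟧ : ℕ → Carrier
  ⟦ m ⟧ = fromℚ (+ m / 1)

  ι-≡ : ∀ {p q} → p ≡ q → fromℚ p ≈ fromℚ q
  ι-≡ p≡q = ι.⟦⟧-cong p≡q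

  ⟦⟧-+ : ∀ m n → ⟦ m ℕ.+ n ⟧ ≈ ⟦ m ⟧ ⊕ ⟦ n ⟧
  ⟦⟧-+ m n = K.trans (ι-≡ (/1-+ m n)) (ι.+-homo _ _)

  ⟦0⟧ : ⟦ 0 ⟧ ≈ K.0#
  ⟦0⟧ = ι.0#-homo

  ⟦1⟧ : ⟦ 1 ⟧ ≈ K.1#
  ⟦1⟧ = ι.1#-homo

  ⟦suc⟧-inverse : ∀ n → ⟦ suc n ⟧ · fromℚ (+ 1 / suc n) ≈ K.1#
  ⟦suc⟧-inverse n = begin
    ⟦ suc n ⟧ · fromℚ (+ 1 / suc n)          ≈⟨ ι.*-homo _ _ ⟨
    fromℚ ((+ suc n / 1) ℚ.* (+ 1 / suc n))  ≈⟨ ι-≡ (trans (/-* (suc n) 1 1 (suc n) (suc n) (ℕ.*-identityˡ _))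
                                                  (/-≡ (suc n ℕ.* 1) 1 (suc n) 1 (trans (ℕ.*-identityʳ _) (ℕ.*-comm (suc n) 1)))) ⟩
    fromℚ (+ 1 / 1)                          ≈⟨ ⟦1⟧ ⟩
    K.1#                                     ∎

  -- The inverse of n + 1 is the image of a rational number; no division in K is involved.
  ⟦suc⟧-cancel : ∀ n {a b} → ⟦ suc n ⟧ · a ≈ ⟦ suc n ⟧ · b → a ≈ b
  ⟦suc⟧-cancel n {a} {b} eq = begin
    a                                        ≈⟨ undo a ⟨
    fromℚ (+ 1 / suc n) · (⟦ suc n ⟧ · a)    ≈⟨ K.*-congˡ eq ⟩
    fromℚ (+ 1 / suc n) · (⟦ suc n ⟧ · b)    ≈⟨ undo b ⟩
    b                                        ∎
    where
    undo : ∀ x → fromℚ (+ 1 / suc n) · (⟦ suc n ⟧ · x) ≈ x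
    undo x = begin
      fromℚ (+ 1 / suc n) · (⟦ suc n ⟧ · x)
        ≈⟨ solve 3 (λ i m y → i :* (m :* y) := (m :* i) :* y) K.refl (fromℚ (+ 1 / suc n)) ⟦ suc n ⟧ x ⟩
      ⟦ suc n ⟧ · fromℚ (+ 1 / suc n) · x  ≈⟨ K.*-congʳ (⟦suc⟧-inverse n) ⟩
      K.1# · x                             ≈⟨ K.*-identityˡ x ⟩
      x                                    ∎

  -- Differentiation and linear differential equations

  D : Series → Series
  D f n = ⟦ suc n ⟧ · f (suc n)

  -- θ = x d/dx does not move coefficients, so that its product rule can be checked term by term.
  θ : Series → Series
  θ f n = ⟦ n ⟧ · f n

  θ-* : ∀ f g → θ (f * g) ≋ θ f * g + f * θ g
  θ-* f g n = begin
    ⟦ n ⟧ · (f * g) n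
      ≈⟨ *-distribˡ-sum ⟦ n ⟧ (λ (i : Fin (suc n)) → f (toℕ i) · g (n ∸ toℕ i)) ⟩
    sum (λ (i : Fin (suc n)) → ⟦ n ⟧ · (f (toℕ i) · g (n ∸ toℕ i)))
      ≈⟨ sum-cong-≋ leibniz ⟩
    sum (λ (i : Fin (suc n)) → θ f (toℕ i) · g (n ∸ toℕ i) ⊕ f (toℕ i) · θ g (n ∸ toℕ i))
      ≈⟨ ∑-distrib-+ (λ (i : Fin (suc n)) → θ f (toℕ i) · g (n ∸ toℕ i)) (λ i → f (toℕ i) · θ g (n ∸ toℕ i)) ⟩
    (θ f * g) n ⊕ (f * θ g) n ∎
    where
    leibniz : ∀ (i : Fin (suc n)) → ⟦ n ⟧ · (f (toℕ i) · g (n ∸ toℕ i)) ≈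
              θ f (toℕ i) · g (n ∸ toℕ i) ⊕ f (toℕ i) · θ g (n ∸ toℕ i)
    leibniz i = begin
      ⟦ n ⟧ · (f (toℕ i) · g (n ∸ toℕ i))
        ≡⟨ cong (λ m → ⟦ m ⟧ · (f (toℕ i) · g (n ∸ toℕ i))) (ℕ.m+[n∸m]≡n (ℕ.≤-pred (Fin.toℕ<n i))) ⟨
      ⟦ toℕ i ℕ.+ (n ∸ toℕ i) ⟧ · (f (toℕ i) · g (n ∸ toℕ i))
        ≈⟨ K.*-congʳ (⟦⟧-+ (toℕ i) (n ∸ toℕ i)) ⟩
      (⟦ toℕ i ⟧ ⊕ ⟦ n ∸ toℕ i ⟧) · (f (toℕ i) · g (n ∸ toℕ i))
        ≈⟨ solve 4 (λ a b x y → (a :+ b) :* (x :* y) := a :* x :* y :+ x :* (b :* y)) K.refl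
                 ⟦ toℕ i ⟧ ⟦ n ∸ toℕ i ⟧ (f (toℕ i)) (g (n ∸ toℕ i)) ⟩
      θ f (toℕ i) · g (n ∸ toℕ i) ⊕ f (toℕ i) · θ g (n ∸ toℕ i) ∎

  -- Since θ f = x · D f, coefficient n + 1 of the product rule for θ is coefficient n of the one
  -- for D. Both summands have the derivative on the left so that `dropZero` treats them alike.
  D-* : ∀ f g → D (f * g) ≋ D f * g + D g * f
  D-* f g n = begin
    θ (f * g) (suc n)                          ≈⟨ θ-* f g (suc n) ⟩
    (θ f * g) (suc n) ⊕ (f * θ g) (suc n)      ≈⟨ K.+-congˡ (*-comm f (θ g) (suc n)) ⟩
    (θ f * g) (suc n) ⊕ (θ g * f) (suc n)      ≈⟨ K.+-cong (dropZero f g) (dropZero g f) ⟩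
    (D f * g) n ⊕ (D g * f) n                  ∎
    where
    dropZero : ∀ f g → (θ f * g) (suc n) ≈ (D f * g) n
    dropZero f g = begin
      ⟦ 0 ⟧ · f 0 · g (suc n) ⊕ (D f * g) n  ≈⟨ K.+-congʳ (K.*-congʳ (K.*-congʳ ⟦0⟧)) ⟩
      K.0# · f 0 · g (suc n) ⊕ (D f * g) n   ≈⟨ solve 3 (λ x y z → con 0 :* x :* y :+ z := z) K.refl (f 0) (g (suc n)) _ ⟩
      (D f * g) n                            ∎

  D-cong : ∀ {f g} → f ≋ g → D f ≋ D g
  D-cong f≋g n = K.*-congˡ (f≋g (suc n))

  D-+ : ∀ f g → D (f + g) ≋ D f + D g
  D-+ f g n = K.distribˡ _ _ _

  D-const-* : ∀ a f → D (const a * f) ≋ const a * D f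
  D-const-* a f n = begin
    ⟦ suc n ⟧ · (const a * f) (suc n)  ≈⟨ K.*-congˡ (const-* a f (suc n)) ⟩
    ⟦ suc n ⟧ · (a · f (suc n))        ≈⟨ solve 3 (λ m x y → m :* (x :* y) := x :* (m :* y)) K.refl ⟦ suc n ⟧ a (f (suc n)) ⟩
    a · D f n                          ≈⟨ const-* a (D f) n ⟨
    (const a * D f) n                  ∎

  D-∫ : ∀ f → D (∫ f) ≋ f
  D-∫ f n = begin
    ⟦ suc n ⟧ · (fromℚ (+ 1 / suc n) · f n)  ≈⟨ K.*-assoc _ _ _ ⟨
    ⟦ suc n ⟧ · fromℚ (+ 1 / suc n) · f n    ≈⟨ K.*-congʳ (⟦suc⟧-inverse n) ⟩
    K.1# · f n                               ≈⟨ K.*-identityˡ _ ⟩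
    f n                                      ∎

  D-X : D X ≋ const K.1#
  D-X zero    = K.trans (K.*-congʳ ⟦1⟧) (K.*-identityˡ _)
  D-X (suc n) = K.zeroʳ _

  -- Coefficient m of the equation expresses (m + 1) f(m+1) through f(0), ..., f(m). As the product
  -- involves all of these, `agree` proves equality up to a bound.
  ode-unique : ∀ h r {f g} → f 0 ≈ g 0 → D f ≋ h * f + r → D g ≋ h * g + r → f ≋ g
  ode-unique h r {f} {g} f₀≈g₀ Df Dg n = agree n ℕ.≤-refl
    where
    agree : ∀ n {m} → m ℕ.≤ n → f m ≈ g m
    agree n       {zero}  _           = f₀≈g₀
    agree (suc n) {suc m} (ℕ.s≤s m≤n) = ⟦suc⟧-cancel m (begin
      D f m              ≈⟨ Df m ⟩
      (h * f) m ⊕ r m    ≈⟨ K.+-congʳ (*-localˡ h m (λ l≤m → agree n (ℕ.≤-trans l≤m m≤n))) ⟩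
      (h * g) m ⊕ r m    ≈⟨ Dg m ⟨
      D g m              ∎)

  inv! : ∀ n → ⟦ suc n ⟧ · 1/ suc n ! ≈ 1/ n !
  inv! n = K.trans (K.sym (ι.*-homo _ _)) (ι-≡ (trans
    (/-* (suc n) 1 1 (suc n !) (suc n !) {{_}} {{suc n ℕ.!≢0}} {{suc n ℕ.!≢0}} (ℕ.*-identityˡ _))
    (/-≡ (suc n ℕ.* 1) 1 (suc n !) (n !) {{suc n ℕ.!≢0}} {{n ℕ.!≢0}}
      (trans (cong (ℕ._* n !) (ℕ.*-identityʳ (suc n))) (sym (ℕ.*-identityˡ _))))))

  0!⁻¹ : 1/ 0 ! ≈ K.1#
  0!⁻¹ = ⟦1⟧

  -- The exponential of a series

  module Exp (f : Series) where
    g : Series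
    g = f - const (f 0)

    g₀ : g 0 ≈ K.0#
    g₀ = K.-‿inverseʳ _

    D-g : D g ≋ D f
    D-g n = K.*-congˡ (K.trans (K.+-congˡ -0≈0) (K.+-identityʳ _))
      where
      -0≈0 : K.- K.0# ≈ K.0#
      -0≈0 = K.trans (K.sym (K.+-identityˡ _)) (K.-‿inverseʳ _)

    D-g^ : ∀ j → D (g ^ suc j) ≋ const ⟦ suc j ⟧ * (D g * g ^ j)
    D-g^ zero =
      D (g * const K.1#)                         ≋⟨ D-cong (S.*-identityʳ g) ⟩
      D g                                        ≋⟨ solveₛ 1 (λ x → x :=ₛ conₛ 1 :*ₛ (x :*ₛ conₛ 1)) S.refl (D g) ⟩
      const K.1# * (D g * const K.1#)            ≋˘⟨ *-congʳ (D g * const K.1#) const-⟦1⟧ ⟩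
      const ⟦ 1 ⟧ * (D g * const K.1#)           ∎ₛ
      where
      const-⟦1⟧ : const ⟦ 1 ⟧ ≋ const K.1#
      const-⟦1⟧ zero    = ⟦1⟧
      const-⟦1⟧ (suc n) = K.refl
    D-g^ (suc j) =
      D (g * g ^ suc j)                                          ≋⟨ D-* g (g ^ suc j) ⟩
      D g * g ^ suc j + D (g ^ suc j) * g                        ≋⟨ S.+-congˡ (*-congʳ g (D-g^ j)) ⟩
      D g * (g * g ^ j) + const ⟦ suc j ⟧ * (D g * g ^ j) * g
        ≋⟨ solveₛ 4 (λ x y z m → x :*ₛ (y :*ₛ z) :+ₛ m :*ₛ (x :*ₛ z) :*ₛ y :=ₛ (conₛ 1 :+ₛ m) :*ₛ (x :*ₛ (y :*ₛ z))) S.refl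
                  (D g) g (g ^ j) (const ⟦ suc j ⟧) ⟩
      (const K.1# + const ⟦ suc j ⟧) * (D g * g ^ suc j)         ≋˘⟨ *-congʳ (D g * g ^ suc j) const-suc ⟩
      const ⟦ suc (suc j) ⟧ * (D g * g ^ suc j)                  ∎ₛ
      where
      const-suc : const ⟦ suc (suc j) ⟧ ≋ const K.1# + const ⟦ suc j ⟧
      const-suc zero    = K.trans (⟦⟧-+ 1 (suc j)) (K.+-congʳ ⟦1⟧)
      const-suc (suc n) = K.sym (K.+-identityˡ _)

    -- In the definition of `exp` the number of summands grows with the coefficient. With a fixed
    -- number J of them the sum is one of series and can be differentiated.
    partial : ℕ → Series
    partial zero    = const K.0#
    partial (suc J) = partial J + const (1/ J !) * g ^ J

    -- The derivative of gʲ/j! is g′ gʲ⁻¹/(j-1)!, and that of the term j = 0 vanishes, so one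
    -- summand is lost.
    D-partial : ∀ J → D (partial (suc J)) ≋ D g * partial J
    D-partial zero n = begin
      ⟦ suc n ⟧ · (K.0# ⊕ (const (1/ 0 !) * const K.1#) (suc n))  ≈⟨ K.*-congˡ (K.+-congˡ (const-* (1/ 0 !) (const K.1#) (suc n))) ⟩
      ⟦ suc n ⟧ · (K.0# ⊕ 1/ 0 ! · K.0#)                          ≈⟨ solve 2 (λ x y → x :* (con 0 :+ y :* con 0) := con 0) K.refl _ _ ⟩
      K.0#                                                        ≈⟨ *-zeroˡ (D g) const-0 n ⟨
      (const K.0# * D g) n                                        ≈⟨ *-comm (const K.0#) (D g) n ⟩
      (D g * const K.0#) n                                        ∎
    D-partial (suc J) =
      D (partial (suc J) + const (1/ suc J !) * g ^ suc J)
        ≋⟨ D-+ (partial (suc J)) (const (1/ suc J !) * g ^ suc J) ⟩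
      D (partial (suc J)) + D (const (1/ suc J !) * g ^ suc J)
        ≋⟨ S.+-cong (D-partial J) (S.trans (D-const-* (1/ suc J !) (g ^ suc J)) (*-congˡ (const (1/ suc J !)) (D-g^ J))) ⟩
      D g * partial J + const (1/ suc J !) * (const ⟦ suc J ⟧ * (D g * g ^ J))
        ≋⟨ solveₛ 5 (λ x p w m y → x :*ₛ p :+ₛ w :*ₛ (m :*ₛ (x :*ₛ y)) :=ₛ x :*ₛ (p :+ₛ (m :*ₛ w) :*ₛ y)) S.refl
                  (D g) (partial J) (const (1/ suc J !)) (const ⟦ suc J ⟧) (g ^ J) ⟩
      D g * (partial J + (const ⟦ suc J ⟧ * const (1/ suc J !)) * g ^ J)
        ≋⟨ *-congˡ (D g) (S.+-congˡ {partial J} (*-congʳ (g ^ J) const-inv!)) ⟩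
      D g * partial (suc J) ∎ₛ
      where
      const-inv! : const ⟦ suc J ⟧ * const (1/ suc J !) ≋ const (1/ J !)
      const-inv! zero    = K.trans (const-* ⟦ suc J ⟧ (const (1/ suc J !)) 0) (inv! J)
      const-inv! (suc n) = K.trans (const-* ⟦ suc J ⟧ (const (1/ suc J !)) (suc n)) (K.zeroʳ _)

    g^-order : ∀ j {n} → n ℕ.< j → (g ^ j) n ≈ K.0#
    g^-order (suc j) {zero}  _           = K.trans (K.+-identityʳ _) (K.trans (K.*-congʳ g₀) (K.zeroˡ _))
    g^-order (suc j) {suc n} (ℕ.s≤s n<j) = begin
      g 0 · (g ^ j) (suc n) ⊕ (shift g * g ^ j) n  ≈⟨ K.+-cong (K.*-congʳ g₀)
                                                      (*-localˡ (shift g) n (λ m≤n → g^-order j (ℕ.≤-<-trans m≤n n<j))) ⟩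
      K.0# · (g ^ j) (suc n) ⊕ (shift g * (λ _ → K.0#)) n  ≈⟨ K.+-cong (K.zeroˡ _) (K.trans (*-comm (shift g) (λ _ → K.0#) n) (*-zeroˡ (shift g) (λ _ → K.refl) n)) ⟩
      K.0# ⊕ K.0#                                  ≈⟨ K.+-identityˡ _ ⟩
      K.0#                                         ∎

    partial-stable : ∀ n r → partial (r ℕ.+ suc n) n ≈ partial (suc n) n
    partial-stable n zero    = K.refl
    partial-stable n (suc r) = begin
      partial (r ℕ.+ suc n) n ⊕ (const (1/ (r ℕ.+ suc n) !) * g ^ (r ℕ.+ suc n)) n
        ≈⟨ K.+-cong (partial-stable n r) (K.trans (const-* (1/ (r ℕ.+ suc n) !) (g ^ (r ℕ.+ suc n)) n)
             (K.trans (K.*-congˡ (g^-order (r ℕ.+ suc n) (ℕ.m≤n+m (suc n) r))) (K.zeroʳ _))) ⟩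
      partial (suc n) n ⊕ K.0#  ≈⟨ K.+-identityʳ _ ⟩
      partial (suc n) n         ∎

    -- The constant term of g is zero, so gʲ with j > n does not reach degree n.
    partial-≤ : ∀ {n m} → n ℕ.≤ m → partial (suc m) n ≈ partial (suc n) n
    partial-≤ {n} {m} n≤m = begin
      partial (suc m) n                  ≡⟨ cong (λ J → partial J n) (sym (trans (ℕ.+-suc (m ∸ n) n) (cong suc (ℕ.m∸n+n≡m n≤m)))) ⟩
      partial (m ∸ n ℕ.+ suc n) n        ≈⟨ partial-stable n (m ∸ n) ⟩
      partial (suc n) n                  ∎

    sum-partial : ∀ J n → sum {J} (λ j → 1/ toℕ j ! · (g ^ toℕ j) n) ≈ partial J n
    sum-partial zero    zero    = K.refl
    sum-partial zero    (suc n) = K.refl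
    sum-partial (suc J) n       = begin
      sum {suc J} (λ j → 1/ toℕ j ! · (g ^ toℕ j) n)
        ≈⟨ sum-init-last {J} (λ j → 1/ toℕ j ! · (g ^ toℕ j) n) ⟩
      sum {J} (λ j → 1/ toℕ (inject₁ j) ! · (g ^ toℕ (inject₁ j)) n) ⊕ 1/ toℕ (fromℕ J) ! · (g ^ toℕ (fromℕ J)) n
        ≈⟨ K.+-cong
             (sum-cong-≋ {J} (λ j → K.reflexive (cong (λ i → 1/ i ! · (g ^ i) n) (Fin.toℕ-inject₁ j))))
             (K.reflexive (cong (λ i → 1/ i ! · (g ^ i) n) (Fin.toℕ-fromℕ J))) ⟩
      sum {J} (λ j → 1/ toℕ j ! · (g ^ toℕ j) n) ⊕ 1/ J ! · (g ^ J) n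
        ≈⟨ K.+-cong (sum-partial J n) (K.sym (const-* (1/ J !) (g ^ J) n)) ⟩
      partial (suc J) n ∎

    exp-partial : ∀ n → exp f n ≈ expScalar (f 0) · partial (suc n) n
    exp-partial n = K.*-congˡ (sum-partial (suc n) n)

  D-exp : ∀ f → D (exp f) ≋ D f * exp f
  D-exp f n = begin
    ⟦ suc n ⟧ · exp f (suc n)
      ≈⟨ K.*-congˡ (exp-partial (suc n)) ⟩
    ⟦ suc n ⟧ · (a · partial (2 ℕ.+ n) (suc n))
      ≈⟨ solve 3 (λ m x y → m :* (x :* y) := x :* (m :* y)) K.refl ⟦ suc n ⟧ a (partial (2 ℕ.+ n) (suc n)) ⟩
    a · D (partial (2 ℕ.+ n)) n
      ≈⟨ K.*-congˡ (D-partial (suc n) n) ⟩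
    a · (D g * partial (suc n)) n
      -- Up to degree n, the truncation `partial (suc n)` coincides with the diagonal sequence,
      -- which is `exp f` without its scalar factor.
      ≈⟨ K.*-congˡ (*-local n (λ {m} _ → D-g m) partial-≤) ⟩
    a · (D f * (λ m → partial (suc m) m)) n
      ≈⟨ K.*-congˡ (*-comm (D f) (λ m → partial (suc m) m) n) ⟩
    a · ((λ m → partial (suc m) m) * D f) n
      ≈⟨ scale-* a (λ m → partial (suc m) m) (D f) n ⟨
    ((λ m → a · partial (suc m) m) * D f) n
      ≈⟨ *-congʳ (D f) (λ m → K.sym (exp-partial m)) n ⟩
    (exp f * D f) n
      ≈⟨ *-comm (exp f) (D f) n ⟩
    (D f * exp f) n ∎
    where
    open Exp f
    a = expScalar (f 0)

  exp-0 : ∀ f → exp f 0 ≈ expScalar (f 0)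
  exp-0 f = K.trans (K.*-congˡ (K.trans (K.+-identityʳ _) (K.trans (K.*-congʳ 0!⁻¹) (K.*-identityˡ _)))) (K.*-identityʳ _)

  eˣ : Series
  eˣ = exp X

  eˣ-0 : eˣ 0 ≈ K.1#
  eˣ-0 = K.trans (exp-0 X) e.ε-homo

  D-eˣ : D eˣ ≋ eˣ
  D-eˣ = S.trans (D-exp X) (S.trans (*-congʳ eˣ D-X) (S.*-identityˡ eˣ))

  -- Exponential generating functions

  egf : (ℕ → ℕ) → Series
  egf a n = fromℚ (_/_ (+ a n) (n !) {{n ℕ.!≢0}})

  egf-⟦⟧ : ∀ a n → egf a n ≈ ⟦ a n ⟧ · 1/ n !
  egf-⟦⟧ a n = K.trans (ι-≡ (sym (trans
      (/-* (a n) 1 1 (n !) (n !) {{_}} {{n ℕ.!≢0}} {{n ℕ.!≢0}} (ℕ.*-identityˡ _))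
      (/-≡ (a n ℕ.* 1) (a n) (n !) (n !) {{n ℕ.!≢0}} {{n ℕ.!≢0}} (cong (ℕ._* n !) (ℕ.*-identityʳ (a n)))))))
    (ι.*-homo _ _)

  egf-cong : ∀ {a b} → (∀ n → a n ≡ b n) → egf a ≋ egf b
  egf-cong a≗b n = ι-≡ (cong (λ m → _/_ (+ m) (n !) {{n ℕ.!≢0}}) (a≗b n))

  egf-+ : ∀ a b → egf (λ n → a n ℕ.+ b n) ≋ egf a + egf b
  egf-+ a b n = begin
    egf (λ n → a n ℕ.+ b n) n            ≈⟨ egf-⟦⟧ (λ n → a n ℕ.+ b n) n ⟩
    ⟦ a n ℕ.+ b n ⟧ · 1/ n !             ≈⟨ K.*-congʳ (⟦⟧-+ (a n) (b n)) ⟩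
    (⟦ a n ⟧ ⊕ ⟦ b n ⟧) · 1/ n !         ≈⟨ K.distribʳ _ _ _ ⟩
    ⟦ a n ⟧ · 1/ n ! ⊕ ⟦ b n ⟧ · 1/ n !  ≈⟨ K.+-cong (egf-⟦⟧ a n) (egf-⟦⟧ b n) ⟨
    egf a n ⊕ egf b n                    ∎

  D-egf : ∀ a → D (egf a) ≋ egf (a ∘ suc)
  D-egf a n = begin
    ⟦ suc n ⟧ · egf a (suc n)                 ≈⟨ K.*-congˡ (egf-⟦⟧ a (suc n)) ⟩
    ⟦ suc n ⟧ · (⟦ a (suc n) ⟧ · 1/ suc n !)  ≈⟨ solve 3 (λ x y z → x :* (y :* z) := y :* (x :* z)) K.refl ⟦ suc n ⟧ ⟦ a (suc n) ⟧ (1/ suc n !) ⟩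
    ⟦ a (suc n) ⟧ · (⟦ suc n ⟧ · 1/ suc n !)  ≈⟨ K.*-congˡ (inv! n) ⟩
    ⟦ a (suc n) ⟧ · 1/ n !                    ≈⟨ egf-⟦⟧ (a ∘ suc) n ⟨
    egf (a ∘ suc) n                           ∎

  -- Either side F of the equation for f has D F = F + G, where G is the same side for f ∘ suc.
  eˣ-*-egf : ∀ f → eˣ * egf f ≋ egf (binomialTransform f)
  eˣ-*-egf f zero    = K.trans (K.+-identityʳ _) (K.trans (K.*-congʳ eˣ-0) (K.*-identityˡ _))
  eˣ-*-egf f (suc n) = ⟦suc⟧-cancel n (begin
    D (eˣ * egf f) n
      ≈⟨ D-* eˣ (egf f) n ⟩
    (D eˣ * egf f) n ⊕ (D (egf f) * eˣ) n
      ≈⟨ K.+-cong (*-congʳ (egf f) D-eˣ n) (K.trans (*-comm (D (egf f)) eˣ n) (*-congˡ eˣ (D-egf f) n)) ⟩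
    (eˣ * egf f) n ⊕ (eˣ * egf (f ∘ suc)) n
      ≈⟨ K.+-cong (eˣ-*-egf f n) (eˣ-*-egf (f ∘ suc) n) ⟩
    egf (binomialTransform f) n ⊕ egf (binomialTransform (f ∘ suc)) n
      ≈⟨ egf-+ (binomialTransform f) (binomialTransform (f ∘ suc)) n ⟨
    egf (binomialTransform f ∘ suc) n
      ≈⟨ D-egf (binomialTransform f) n ⟨
    D (egf (binomialTransform f)) n ∎)

  X-* : ∀ f n → (X * f) (suc n) ≈ f n
  X-* f n = begin
    K.0# · f (suc n) ⊕ (shift X * f) n  ≈⟨ K.+-cong (K.zeroˡ _) (*-congʳ f shift-X n) ⟩
    K.0# ⊕ (const K.1# * f) n           ≈⟨ K.+-identityˡ _ ⟩
    (const K.1# * f) n                  ≈⟨ S.*-identityˡ f n ⟩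
    f n                                 ∎
    where
    shift-X : shift X ≋ const K.1#
    shift-X zero    = K.refl
    shift-X (suc n) = K.refl

  X^-coefficient : ∀ d n → (X ^ d) n ≈ ⟦ δ d n ⟧
  X^-coefficient zero    zero    = K.sym ⟦1⟧
  X^-coefficient zero    (suc n) = K.sym ⟦0⟧
  X^-coefficient (suc d) zero    = K.trans (K.+-identityʳ _) (K.trans (K.zeroˡ _) (K.sym ⟦0⟧))
  X^-coefficient (suc d) (suc n) = K.trans (X-* (X ^ d) n) (X^-coefficient d n)

  egf-δ : ∀ d → egf (δ d) ≋ const (1/ d !) * X ^ d
  egf-δ d n = begin
    egf (δ d) n                 ≈⟨ egf-⟦⟧ (δ d) n ⟩
    ⟦ δ d n ⟧ · 1/ n !          ≈⟨ supported ⟩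
    1/ d ! · ⟦ δ d n ⟧          ≈⟨ K.*-congˡ (X^-coefficient d n) ⟨
    1/ d ! · (X ^ d) n          ≈⟨ const-* _ (X ^ d) n ⟨
    (const (1/ d !) * X ^ d) n  ∎
    where
    supported : ⟦ δ d n ⟧ · 1/ n ! ≈ 1/ d ! · ⟦ δ d n ⟧
    supported with d ℕ.≟ n
    ... | yes refl = K.*-comm _ _
    ... | no  d≢n rewrite δ-offDiagonal d≢n =
      K.trans (K.*-congʳ ⟦0⟧) (K.trans (K.zeroˡ _) (K.sym (K.trans (K.*-congˡ ⟦0⟧) (K.zeroʳ _))))

  D-egf-recurrence : ∀ {a b} → (∀ n → a (suc n) ≡ binomialTransform b n) → D (egf a) ≋ eˣ * egf b
  D-egf-recurrence {a} {b} rec = S.trans (D-egf a) (S.trans (egf-cong rec) (S.sym (eˣ-*-egf b)))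

  -- The closed forms solve the differential equations

  0ₛ : Series
  0ₛ = const K.0#

  egf-closedForm₁ : ∀ {a} → a 0 ≡ 1 → (∀ n → a (suc n) ≡ binomialTransform a n) → egf a ≋ closedForm 1
  egf-closedForm₁ {a} a₀ rec = ode-unique eˣ 0ₛ initial
    (S.trans (D-egf-recurrence {a} {a} rec) (S.sym (S.+-identityʳ (eˣ * egf a))))
    (S.trans (D-exp (eˣ - const K.1#)) (S.trans (*-congʳ (closedForm 1) D-base) (S.sym (S.+-identityʳ (eˣ * closedForm 1)))))
    where
    initial : egf a 0 ≈ closedForm 1 0
    initial = begin
      egf a 0                      ≈⟨ egf-⟦⟧ a 0 ⟩
      ⟦ a 0 ⟧ · 1/ 0 !             ≡⟨ cong (λ m → ⟦ m ⟧ · 1/ 0 !) a₀ ⟩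
      ⟦ 1 ⟧ · 1/ 0 !               ≈⟨ K.*-cong ⟦1⟧ 0!⁻¹ ⟩
      K.1# · K.1#                  ≈⟨ K.*-identityˡ _ ⟩
      K.1#                         ≈⟨ e.ε-homo ⟨
      -- The constant term of eˣ is 1, and the subtracted 1 in the exponent cancels it; this fixes
      -- the initial value 1.
      expScalar K.0#               ≈⟨ e.⟦⟧-cong (K.trans (K.+-congʳ eˣ-0) (K.-‿inverseʳ _)) ⟨
      expScalar ((eˣ - const K.1#) 0) ≈⟨ exp-0 (eˣ - const K.1#) ⟨
      closedForm 1 0               ∎
    D-base : D (eˣ - const K.1#) ≋ eˣ
    D-base n = begin
      ⟦ suc n ⟧ · (eˣ (suc n) ⊕ K.- K.0#)  ≈⟨ K.*-congˡ (K.+-congˡ (K.trans (K.sym (K.+-identityˡ _)) (K.-‿inverseʳ _))) ⟩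
      ⟦ suc n ⟧ · (eˣ (suc n) ⊕ K.0#)      ≈⟨ K.*-congˡ (K.+-identityʳ _) ⟩
      D eˣ n                               ≈⟨ D-eˣ n ⟩
      eˣ n                                 ∎

  -- Variation of constants, with k = d + 2. The series u solves the homogeneous equation u′ = eˣ u.
  -- In (u w I)′ the term u w I′ must then be eˣ xᵏ⁻¹/(k-1)!, which holds because I′ = xᵏ⁻¹ v and u
  -- v = eˣ.
  egf-closedForm₂ : ∀ d {a} → a 0 ≡ 0 → (∀ n → a (suc n) ≡ binomialTransform (λ j → a j ℕ.+ δ (suc d) j) n) →
                    egf a ≋ closedForm (2 ℕ.+ d)
  egf-closedForm₂ d {a} a₀ rec = ode-unique eˣ (eˣ * (w * X ^ suc d)) initial D-lhs D-rhs
    where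
    w u v I : Series
    w = const (1/ (suc d) !)
    u = exp eˣ
    v = exp (- eˣ + X)
    I = ∫ (X ^ suc d * v)

    initial : egf a 0 ≈ closedForm (2 ℕ.+ d) 0
    initial = begin
      egf a 0               ≈⟨ egf-⟦⟧ a 0 ⟩
      ⟦ a 0 ⟧ · 1/ 0 !      ≡⟨ cong (λ m → ⟦ m ⟧ · 1/ 0 !) a₀ ⟩
      ⟦ 0 ⟧ · 1/ 0 !        ≈⟨ K.trans (K.*-congʳ ⟦0⟧) (K.zeroˡ _) ⟩
      K.0#                  ≈⟨ K.trans (K.+-identityʳ _) (K.zeroʳ _) ⟨
      (u * w * I) 0         ∎

    D-lhs : D (egf a) ≋ eˣ * egf a + eˣ * (w * X ^ suc d)
    D-lhs =
      D (egf a)                                     ≋⟨ D-egf-recurrence {a} {λ j → a j ℕ.+ δ (suc d) j} rec ⟩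
      eˣ * egf (λ j → a j ℕ.+ δ (suc d) j)          ≋⟨ *-congˡ eˣ (egf-+ a (δ (suc d))) ⟩
      eˣ * (egf a + egf (δ (suc d)))                ≋⟨ *-congˡ eˣ (S.+-congˡ {egf a} (egf-δ (suc d))) ⟩
      eˣ * (egf a + w * X ^ suc d)                  ≋⟨ S.distribˡ eˣ (egf a) (w * X ^ suc d) ⟩
      eˣ * egf a + eˣ * (w * X ^ suc d)             ∎ₛ

    D-u : D u ≋ eˣ * u
    D-u = S.trans (D-exp eˣ) (*-congʳ u D-eˣ)

    D-v : D v ≋ (- eˣ + const K.1#) * v
    D-v = S.trans (D-exp (- eˣ + X)) (*-congʳ v (S.trans (D-+ (- eˣ) X) (S.+-cong D-neg D-X)))
      where
      D-neg : D (- eˣ) ≋ - eˣ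
      D-neg n = K.trans (K.sym (-‿distribʳ-* ⟦ suc n ⟧ (eˣ (suc n)))) (K.-‿cong (D-eˣ n))
        where open import Algebra.Properties.Ring K.ring using (-‿distribʳ-*)

    -- Both sides solve y′ = y: the contributions eˣ and -eˣ of the two exponents cancel. At 0 the
    -- scalars e and e⁻¹ cancel because `expScalar` is a homomorphism.
    u*v : u * v ≋ eˣ
    u*v = ode-unique (const K.1#) 0ₛ uv-0
      (
        D (u * v)                                          ≋⟨ D-* u v ⟩
        D u * v + D v * u                                  ≋⟨ S.+-cong (*-congʳ v D-u) (*-congʳ u D-v) ⟩
        eˣ * u * v + (- eˣ + const K.1#) * v * u
          ≋⟨ solveₛ 4 (λ x m y z → x :*ₛ y :*ₛ z :+ₛ (m :+ₛ conₛ 1) :*ₛ z :*ₛ y :=ₛ (m :+ₛ x :+ₛ conₛ 1) :*ₛ (y :*ₛ z)) S.refl eˣ (- eˣ) u v ⟩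
        (- eˣ + eˣ + const K.1#) * (u * v)                 ≋⟨ *-congʳ (u * v) (S.+-congʳ {const K.1#} (S.-‿inverseˡ eˣ)) ⟩
        (0ₛ + const K.1#) * (u * v)                        ≋⟨ solveₛ 1 (λ y → (conₛ 0 :+ₛ conₛ 1) :*ₛ y :=ₛ conₛ 1 :*ₛ y :+ₛ conₛ 0) S.refl (u * v) ⟩
        const K.1# * (u * v) + 0ₛ                          ∎ₛ)
      (S.trans D-eˣ (solveₛ 1 (λ y → y :=ₛ conₛ 1 :*ₛ y :+ₛ conₛ 0) S.refl eˣ))
      where
      uv-0 : (u * v) 0 ≈ eˣ 0
      uv-0 = begin
        u 0 · v 0 ⊕ K.0#                                     ≈⟨ K.+-identityʳ _ ⟩
        u 0 · v 0                                            ≈⟨ K.*-cong (exp-0 eˣ) (exp-0 (- eˣ + X)) ⟩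
        expScalar (eˣ 0) · expScalar (K.- eˣ 0 ⊕ K.0#)       ≈⟨ e.homo _ _ ⟨
        expScalar (eˣ 0 ⊕ (K.- eˣ 0 ⊕ K.0#))                 ≈⟨ e.⟦⟧-cong (K.trans (K.+-congˡ (K.+-identityʳ _)) (K.-‿inverseʳ _)) ⟩
        expScalar K.0#                                       ≈⟨ e.ε-homo ⟩
        K.1#                                                 ≈⟨ eˣ-0 ⟨
        eˣ 0                                                 ∎

    D-rhs : D (u * w * I) ≋ eˣ * (u * w * I) + eˣ * (w * X ^ suc d)
    D-rhs =
      D (u * w * I)                                ≋⟨ D-* (u * w) I ⟩
      D (u * w) * I + D I * (u * w)                ≋⟨ S.+-cong (*-congʳ I D-uw) (*-congʳ (u * w) (D-∫ (X ^ suc d * v))) ⟩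
      w * (eˣ * u) * I + X ^ suc d * v * (u * w)
        ≋⟨ solveₛ 6 (λ x y z m n o → m :*ₛ (x :*ₛ y) :*ₛ n :+ₛ o :*ₛ z :*ₛ (y :*ₛ m) :=ₛ x :*ₛ (y :*ₛ m :*ₛ n) :+ₛ (y :*ₛ z) :*ₛ (m :*ₛ o)) S.refl
                  eˣ u v w I (X ^ suc d) ⟩
      eˣ * (u * w * I) + u * v * (w * X ^ suc d)   ≋⟨ S.+-congˡ (*-congʳ (w * X ^ suc d) u*v) ⟩
      eˣ * (u * w * I) + eˣ * (w * X ^ suc d)      ∎ₛ
      where
      D-uw : D (u * w) ≋ w * (eˣ * u)
      D-uw = S.trans (D-cong (*-comm u w)) (S.trans (D-const-* (1/ (suc d) !) u) (*-congˡ w D-u))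

-- Finite enumerations

-- P is given without a decision procedure; a duplicate-free list of its elements serves as the
-- count. Two such lists are permutations of each other, so a number is found by transporting an
-- enumeration along equivalences and injections to one of known length.
record HasSize {A : Set} (P : A → Set) (n : ℕ) : Set where
  field
    elements : List A
    unique   : Unique elements
    sound    : ∀ {x} → x ∈ elements → P x
    complete : ∀ {x} → P x → x ∈ elements
    size     : length elements ≡ n

open HasSize

size-unique : ∀ {A : Set} {P : A → Set} {m n} → HasSize P m → HasSize P n → m ≡ n
size-unique S T = trans (sym (size S)) (trans (↭.↭-length S↭T) (size T))
  where
  S↭T : elements S ↭ elements T
  S↭T = ∼bag⇒↭ (∈.unique∧set⇒bag (unique S) (unique T)
    (mk⇔ (complete T ∘ sound S) (complete S ∘ sound T)))

size-⇔ : ∀ {A : Set} {P Q : A → Set} {n} → (∀ {x} → P x → Q x) → (∀ {x} → Q x → P x) →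
         HasSize P n → HasSize Q n
size-⇔ to from S = record
  { elements = elements S
  ; unique   = unique S
  ; sound    = to ∘ sound S
  ; complete = complete S ∘ from
  ; size     = size S
  }

size-none : ∀ {A : Set} {P : A → Set} → (∀ {x} → ¬ P x) → HasSize P 0
size-none none = record
  { elements = []
  ; unique   = []
  ; sound    = λ ()
  ; complete = λ Px → contradiction Px none
  ; size     = refl
  }

size-one : ∀ {A : Set} {P : A → Set} {a} → P a → (∀ {x} → P x → x ≡ a) → HasSize P 1
size-one {a = a} Pa only = record
  { elements = a ∷ []
  ; unique   = [] ∷ []
  ; sound    = λ { (here refl) → Pa }
  ; complete = here ∘ only
  ; size     = refl
  }

size-⊎ : ∀ {A : Set} {P Q : A → Set} {m n} → (∀ {x} → P x → ¬ Q x) → HasSize P m → HasSize Q n →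
         HasSize (λ x → P x ⊎ Q x) (m ℕ.+ n)
size-⊎ disjoint S T = record
  { elements = elements S ++ elements T
  ; unique   = Unique.++⁺ (unique S) (unique T) (λ (x∈S , x∈T) → disjoint (sound S x∈S) (sound T x∈T))
  ; sound    = [ inj₁ ∘ sound S , inj₂ ∘ sound T ] ∘ ∈.∈-++⁻ (elements S)
  ; complete = [ ∈.∈-++⁺ˡ ∘ complete S , ∈.∈-++⁺ʳ (elements S) ∘ complete T ]
  ; size     = trans (List.length-++ (elements S)) (cong₂ ℕ._+_ (size S) (size T))
  }

Unique-map⁺ : ∀ {A B : Set} {f : A → B} {xs} → (∀ {x y} → x ∈ xs → y ∈ xs → f x ≡ f y → x ≡ y) →
              Unique xs → Unique (List.map f xs)
Unique-map⁺ inj []           = []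
Unique-map⁺ inj (x∉xs ∷ xs!) =
  All.map⁺ (All.tabulate (λ y∈xs fx≡fy → All.lookup x∉xs y∈xs (inj (here refl) (there y∈xs) fx≡fy))) ∷
  Unique-map⁺ (λ x∈xs y∈xs → inj (there x∈xs) (there y∈xs)) xs!

-- Injectivity is asked on P alone: gluing a word, a letter and a sorted remainder is injective only
-- on those pairs that arise from splitting an alphabet.
size-image : ∀ {A B : Set} {P : A → Set} {n} (f : A → B) →
             (∀ {x y} → P x → P y → f x ≡ f y → x ≡ y) →
             HasSize P n → HasSize (λ z → ∃[ x ] P x × z ≡ f x) n
size-image f inj S = record
  { elements = List.map f (elements S)
  ; unique   = Unique-map⁺ (λ x∈S y∈S → inj (sound S x∈S) (sound S y∈S)) (unique S)
  ; sound    = λ z∈ → let x , x∈S , z≡fx = ∈.∈-map⁻ f z∈ in x , sound S x∈S , z≡fx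
  ; complete = λ { (x , Px , refl) → ∈.∈-map⁺ f (complete S Px) }
  ; size     = trans (List.length-map f (elements S)) (size S)
  }

-- Choosing a subset of an alphabet

interleaving-All : ∀ {A : Set} {P : A → Set} {l r as} → Interleaving l r as → All P as → All P l × All P r
interleaving-All []         []         = [] , []
interleaving-All (consˡ sp) (px ∷ pxs) = let pl , pr = interleaving-All sp pxs in px ∷ pl , pr
interleaving-All (consʳ sp) (px ∷ pxs) = let pl , pr = interleaving-All sp pxs in pl , px ∷ pr

interleaving-AllPairs : ∀ {A : Set} {R : A → A → Set} {l r as} → Interleaving l r as →
                        AllPairs R as → AllPairs R l × AllPairs R r
interleaving-AllPairs []         []         = [] , []
interleaving-AllPairs (consˡ sp) (px ∷ pxs) =
  let pl , pr = interleaving-AllPairs sp pxs in proj₁ (interleaving-All sp px) ∷ pl , pr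
interleaving-AllPairs (consʳ sp) (px ∷ pxs) =
  let pl , pr = interleaving-AllPairs sp pxs in pl , proj₂ (interleaving-All sp px) ∷ pr

-- The letters of `as` are looked up one by one in `xs ++ ys` and sent to the side where they occur.
-- Thus `l` and `r` are the letters of `xs` and `ys` in the order of `as`, a canonical form of the
-- two subsets.
++-interleaving : ∀ {A : Set} (xs {ys} as : List A) → xs ++ ys ↭ as →
                  ∃[ l ] ∃[ r ] Interleaving l r as × xs ↭ l × ys ↭ r
++-interleaving xs {ys} [] p with List.++-conicalˡ xs ys (↭.↭-empty-inv p) | List.++-conicalʳ xs ys (↭.↭-empty-inv p)
... | refl | refl = [] , [] , [] , ↭-refl , ↭-refl
++-interleaving xs {ys} (a ∷ as) p with ∈.∈-++⁻ xs (↭.∈-resp-↭ (↭-sym p) (here refl))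
... | inj₁ a∈xs with xs₁ , xs₂ , refl ← ∈.∈-∃++ a∈xs
    with l , r , sp , xs↭l , ys↭r ← ++-interleaving (xs₁ ++ xs₂) as
           (↭-trans (↭-reflexive (List.++-assoc xs₁ xs₂ ys))
             (↭.drop-mid xs₁ [] (↭-trans (↭-reflexive (sym (List.++-assoc xs₁ (a ∷ xs₂) ys))) p)))
    = a ∷ l , r , consˡ sp , ↭-trans (↭.shift a xs₁ xs₂) (↭-prep a xs↭l) , ys↭r
++-interleaving xs {ys} (a ∷ as) p | inj₂ a∈ys with ys₁ , ys₂ , refl ← ∈.∈-∃++ a∈ys
    with l , r , sp , xs↭l , ys↭r ← ++-interleaving xs as
           (↭-trans (↭-reflexive (sym (List.++-assoc xs ys₁ ys₂)))
             (↭.drop-mid (xs ++ ys₁) [] (↭-trans (↭-reflexive (List.++-assoc xs ys₁ (a ∷ ys₂))) p)))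
    = l , a ∷ r , consʳ sp , xs↭l , ↭-trans (↭.shift a ys₁ ys₂) (↭-prep a ys↭r)

-- If the first letter goes to `r`, the length of `l` is unaffected; if it goes to `l`, that length
-- grows by one and f becomes `f ∘ suc`. This is the recursion of `binomialTransform`, C(n,j) being
-- the number of choices of an `l` of length j. Only `r` is recorded, since it determines `l`;
-- whether `a` occurs in it separates the two cases.
size-interleavings : ∀ {A B : Set} (as : List A) {f} (Q : List A → B → Set) → Unique as →
                     (∀ {l r} → Interleaving l r as → HasSize (Q l) (f (length l))) →
                     HasSize (λ (b , r) → ∃[ l ] Interleaving l r as × Q l b) (binomialTransform f (length as))
size-interleavings [] Q [] sizes = size-⇔
  (λ { (b , Qb , refl) → [] , [] , Qb })
  (λ { ([] , [] , Qb) → _ , Qb , refl })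
  (size-image (_, []) (λ _ _ → cong proj₁) (sizes []))
size-interleavings {A} {B} (a ∷ as) {f} Q (a∉as ∷ as!) sizes = size-⇔ to from
  (size-⊎ disjoint
    (size-image consRight (λ _ _ eq → cong₂ _,_ (cong proj₁ eq) (List.∷-injectiveʳ (cong proj₂ eq)))
      (size-interleavings as Q as! (sizes ∘ consʳ)))
    (size-interleavings as {f ∘ suc} (Q ∘ (a ∷_)) as! (sizes ∘ consˡ)))
  where
  consRight : B × List A → B × List A
  consRight (b , r) = b , a ∷ r
  Left Right : B × List A → Set
  Right z = ∃[ (b , r) ] (∃[ l ] Interleaving l r as × Q l b) × z ≡ consRight (b , r)
  Left (b , r) = ∃[ l ] Interleaving l r as × Q (a ∷ l) b
  to : ∀ {z} → Right z ⊎ Left z → ∃[ l ] Interleaving l (proj₂ z) (a ∷ as) × Q l (proj₁ z)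
  to {_ , _} (inj₁ ((_ , _) , (l , sp , Qb) , refl)) = l , consʳ sp , Qb
  to (inj₂ (l , sp , Qb)) = a ∷ l , consˡ sp , Qb
  from : ∀ {z} → ∃[ l ] Interleaving l (proj₂ z) (a ∷ as) × Q l (proj₁ z) → Right z ⊎ Left z
  from (_ , consˡ sp , Qb) = inj₂ (_ , sp , Qb)
  from {b , _ ∷ r} (_ , consʳ sp , Qb) = inj₁ ((b , r) , (_ , sp , Qb) , refl)
  disjoint : ∀ {z} → Right z → ¬ Left z
  disjoint {_ , _} ((_ , _) , _ , refl) (_ , sp , _) = All.lookup (proj₂ (interleaving-All sp a∉as)) (here refl) refl

-- Order-isomorphism of words over arbitrary alphabets

Similar : ℕ × ℕ → ℕ × ℕ → Set
Similar (x , y) (x′ , y′) = (x < x′ ⇔ y < y′) × (x′ < x ⇔ y′ < y)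

-- The two words are the projections of one list of pairs. `Similar` is symmetric, so every
-- rearrangement of this list rearranges both words at once and keeps them order-isomorphic.
_≅_ : List ℕ → List ℕ → Set
xs ≅ ys = ∃[ zs ] List.map proj₁ zs ≡ xs × List.map proj₂ zs ≡ ys × AllPairs Similar zs

≅-length : ∀ {xs ys} → xs ≅ ys → length xs ≡ length ys
≅-length (zs , refl , refl , _) = trans (List.length-map proj₁ zs) (sym (List.length-map proj₂ zs))

Increasing : List ℕ → Set
Increasing = AllPairs _<_

module _ {_≼_ : ℕ → ℕ → Set} (isDecTotalOrder : IsDecTotalOrder _≡_ _≼_) where
  private
    O : DecTotalOrder 0ℓ 0ℓ 0ℓ
    O = record { isDecTotalOrder = isDecTotalOrder }

  sorted-↭⇒≡ : ∀ {xs ys} → Linked _≼_ xs → Linked _≼_ ys → xs ↭ ys → xs ≡ ys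
  sorted-↭⇒≡ xs↗ ys↗ xs↭ys =
    Pointwise-≡⇒≡ (Sorting.↗↭↗⇒≋ (DecTotalOrder.totalOrder O) xs↗ ys↗ (↭⇒↭ₛ xs↭ys))

increasing⇒sorted : ∀ {xs} → Increasing xs → Linked _≤_ xs
increasing⇒sorted = Sorting.AllPairs⇒Sorted ℕ.≤-totalOrder ∘ AllPairs.map ℕ.<⇒≤

increasing-↭⇒≡ : ∀ {xs ys} → Increasing xs → Increasing ys → xs ↭ ys → xs ≡ ys
increasing-↭⇒≡ xs↗ ys↗ = sorted-↭⇒≡ ℕ.≤-isDecTotalOrder (increasing⇒sorted xs↗) (increasing⇒sorted ys↗)

AllPairs-resp-↭ : ∀ {A : Set} {R : A → A → Set} {xs ys} → (∀ {x y} → R x y → R y x) →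
                  xs ↭ ys → AllPairs R xs → AllPairs R ys
AllPairs-resp-↭ {R = R} R-sym xs↭ys = ↭ₛ.AllPairs-resp-↭ (setoid _) R-sym (resp₂ R) (↭⇒↭ₛ xs↭ys)

Unique-resp-↭ : ∀ {A : Set} {xs ys : List A} → xs ↭ ys → Unique xs → Unique ys
Unique-resp-↭ = AllPairs-resp-↭ ≢-sym

Similar-sym : ∀ {z z′} → Similar z z′ → Similar z′ z
Similar-sym (p , q) = q , p

map-proj-injective : ∀ {A B : Set} {us vs : List (A × B)} → List.map proj₁ us ≡ List.map proj₁ vs →
                     List.map proj₂ us ≡ List.map proj₂ vs → us ≡ vs
map-proj-injective {us = []}    {[]}    _  _  = refl
map-proj-injective {us = _ ∷ _} {_ ∷ _} eq₁ eq₂ =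
  cong₂ _∷_ (cong₂ _,_ (List.∷-injectiveˡ eq₁) (List.∷-injectiveˡ eq₂))
            (map-proj-injective (List.∷-injectiveʳ eq₁) (List.∷-injectiveʳ eq₂))

-- Here the keys are the letters of a pattern, and they pin down the arrangement: if the head `u`
-- stood further on in the other list, its key would occur twice.
keys-↭⇒≡ : ∀ {A B : Set} {us vs : List (A × B)} → Unique (List.map proj₂ us) →
           List.map proj₂ us ≡ List.map proj₂ vs → us ↭ vs → us ≡ vs
keys-↭⇒≡ {us = []}     {[]}     _          _  _ = refl
keys-↭⇒≡ {us = u ∷ us} {v ∷ vs} (u∉ ∷ us!) eq p with ↭.∈-resp-↭ p (here refl)
... | here refl  = cong (u ∷_) (keys-↭⇒≡ us! (List.∷-injectiveʳ eq) (↭.drop-∷ p))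
... | there u∈vs = contradiction refl (All.lookup u∉ u∈us)
  where
  u∈us : proj₂ u ∈ List.map proj₂ us
  u∈us = subst (proj₂ u ∈_) (sym (List.∷-injectiveʳ eq)) (∈.∈-map⁺ proj₂ u∈vs)

similar-< : ∀ {x x′ y y′} → x < x′ → y < y′ → Similar (x , y) (x′ , y′)
similar-< x<x′ y<y′ = mk⇔ (λ _ → y<y′) (λ _ → x<x′) ,
  mk⇔ (λ x′<x → contradiction x′<x (ℕ.<-asym x<x′)) (λ y′<y → contradiction y′<y (ℕ.<-asym y<y′))

increasing-zip : ∀ {xs ys} → Increasing xs → Increasing ys → length xs ≡ length ys → xs ≅ ys
increasing-zip {xs} {ys} xs↗ ys↗ eq = List.zip xs ys , proj₁-zip xs ys eq , proj₂-zip xs ys eq , similar xs↗ ys↗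
  where
  proj₁-zip : ∀ (xs ys : List ℕ) → length xs ≡ length ys → List.map proj₁ (List.zip xs ys) ≡ xs
  proj₁-zip []       []       _  = refl
  proj₁-zip (x ∷ xs) (y ∷ ys) eq = cong (x ∷_) (proj₁-zip xs ys (ℕ.suc-injective eq))
  proj₂-zip : ∀ (xs ys : List ℕ) → length xs ≡ length ys → List.map proj₂ (List.zip xs ys) ≡ ys
  proj₂-zip []       []       _  = refl
  proj₂-zip (x ∷ xs) (y ∷ ys) eq = cong (y ∷_) (proj₂-zip xs ys (ℕ.suc-injective eq))
  similar-head : ∀ {x y xs ys} → All (x <_) xs → All (y <_) ys → All (Similar (x , y)) (List.zip xs ys)
  similar-head []           _            = []
  similar-head (_ ∷ _)      []           = []
  similar-head (x<x′ ∷ x<) (y<y′ ∷ y<) = similar-< x<x′ y<y′ ∷ similar-head x< y<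
  similar : ∀ {xs ys} → Increasing xs → Increasing ys → AllPairs Similar (List.zip xs ys)
  similar []         _          = []
  similar (_ ∷ _)    []         = []
  similar (x< ∷ xs↗) (y< ∷ ys↗) = similar-head x< y< ∷ similar xs↗ ys↗

increasing-≅ : ∀ zs → AllPairs Similar zs → Increasing (List.map proj₂ zs) → Increasing (List.map proj₁ zs)
increasing-≅ zs sim ys↗ = AllPairs.map⁺ (AllPairs.zipWith
  (λ { {x , y} {x′ , y′} ((p , q) , y<y′) → Equivalence.from p y<y′ }) (sim , AllPairs.map⁻ ys↗))

-- Sorting the pattern sorts every word order-isomorphic to it by the same rearrangement.
size-≅ : ∀ {as ps} → Increasing as → Unique ps → HasSize (λ xs → xs ↭ as × xs ≅ ps) (δ (length ps) (length as))
size-≅ {as} {ps} as↗ ps! with length ps ℕ.≟ length as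
... | no ps≢as = subst (HasSize _) (sym (δ-offDiagonal ps≢as))
  (size-none λ (xs↭as , xs≅ps) → ps≢as (trans (sym (≅-length xs≅ps)) (↭.↭-length xs↭as)))
... | yes ps≡as = subst (HasSize _) (sym (trans (cong (δ (length ps)) (sym ps≡as)) (δ-diagonal (length ps))))
  (size-one (arrangement-↭ , arrangement-≅) only)
  where
  open Sort ℕ.≤-decTotalOrder using (sort; sort-↭; sort-↗)
  qs : List ℕ
  qs = sort ps
  qs! : Unique qs
  qs! = Unique-resp-↭ (↭-sym (sort-↭ ps)) ps!
  qs↗ : Increasing qs
  qs↗ = AllPairs.zipWith (λ (x≤y , x≢y) → ℕ.≤∧≢⇒< x≤y x≢y)
          (Sorting.Sorted⇒AllPairs ℕ.≤-totalOrder (sort-↗ ps) , qs!)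
  as≅qs : as ≅ qs
  as≅qs = increasing-zip as↗ qs↗ (trans (sym ps≡as) (sym (↭.↭-length (sort-↭ ps))))
  ws : List (ℕ × ℕ)
  ws = proj₁ as≅qs
  arranged : ∃[ zs ] ps ≡ List.map proj₂ zs × ws ↭ zs
  arranged = ↭.↭-map-inv proj₂ (subst (_↭ ps) (sym (proj₁ (proj₂ (proj₂ as≅qs)))) (sort-↭ ps))
  zs : List (ℕ × ℕ)
  zs = proj₁ arranged
  ws↭zs : ws ↭ zs
  ws↭zs = proj₂ (proj₂ arranged)
  arrangement-↭ : List.map proj₁ zs ↭ as
  arrangement-↭ = subst (List.map proj₁ zs ↭_) (proj₁ (proj₂ as≅qs)) (↭.map⁺ proj₁ (↭-sym ws↭zs))
  arrangement-≅ : List.map proj₁ zs ≅ ps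
  arrangement-≅ = zs , refl , sym (proj₁ (proj₂ arranged)) ,
    AllPairs-resp-↭ (λ {z} {z′} → Similar-sym {z} {z′}) ws↭zs (proj₂ (proj₂ (proj₂ as≅qs)))
  only : ∀ {xs} → xs ↭ as × xs ≅ ps → xs ≡ List.map proj₁ zs
  only (xs↭as , us , refl , us≡ps , us-similar)
    with vs , qs≡vs , us↭vs ← ↭.↭-map-inv proj₂ (subst (_↭ qs) (sym us≡ps) (↭-sym (sort-↭ ps)))
    = cong (List.map proj₁) (keys-↭⇒≡ (subst Unique (sym us≡ps) ps!) (trans us≡ps (proj₁ (proj₂ arranged)))
        (↭-trans us↭vs (↭-trans (↭-reflexive vs≡ws) ws↭zs)))
    where
    vs-similar : AllPairs Similar vs
    vs-similar = AllPairs-resp-↭ (λ {z} {z′} → Similar-sym {z} {z′}) us↭vs us-similar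
    vs≡as : List.map proj₁ vs ≡ as
    vs≡as = increasing-↭⇒≡ (increasing-≅ vs vs-similar (subst Increasing qs≡vs qs↗)) as↗
              (↭-trans (↭.map⁺ proj₁ (↭-sym us↭vs)) xs↭as)
    vs≡ws : vs ≡ ws
    vs≡ws = map-proj-injective (trans vs≡as (sym (proj₁ (proj₂ as≅qs))))
              (trans (sym qs≡vs) (sym (proj₁ (proj₂ (proj₂ as≅qs)))))

-- Splitting a word at its least letter

++-∷-injective : ∀ {s σ σ′ τ τ′} → All (s <_) σ → All (s <_) σ′ → σ ++ s ∷ τ ≡ σ′ ++ s ∷ τ′ → σ ≡ σ′ × τ ≡ τ′
++-∷-injective []         []         refl = refl , refl
++-∷-injective []         (s<s ∷ _)  refl = contradiction s<s (ℕ.<-irrefl refl)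
++-∷-injective (s<s ∷ _)  []         refl = contradiction s<s (ℕ.<-irrefl refl)
++-∷-injective (_ ∷ s<σ) (_ ∷ s<σ′) eq with refl ← List.∷-injectiveˡ eq =
  let σ≡σ′ , τ≡τ′ = ++-∷-injective s<σ s<σ′ (List.∷-injectiveʳ eq) in cong (_ ∷_) σ≡σ′ , τ≡τ′

-- The three cases are y before s, y at the position of s, and y after s.
++-∷-compare : ∀ {A : Set} {s y : A} σ ω {τ ρ} → σ ++ s ∷ τ ≡ ω ++ y ∷ ρ →
               (∃[ σ′ ] σ ≡ ω ++ y ∷ σ′) ⊎ σ ≡ ω ⊎ (s ∈ ω × y ∈ τ)
++-∷-compare []      []      _    = inj₂ (inj₁ refl)
++-∷-compare []      (_ ∷ ω) refl = inj₂ (inj₂ (here refl , ∈.∈-insert ω))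
++-∷-compare (_ ∷ σ) []      refl = inj₁ (σ , refl)
++-∷-compare (_ ∷ σ) (_ ∷ ω) eq with refl ← List.∷-injectiveˡ eq | ++-∷-compare σ ω (List.∷-injectiveʳ eq)
... | inj₁ (σ′ , refl)         = inj₁ (σ′ , refl)
... | inj₂ (inj₁ refl)         = inj₂ (inj₁ refl)
... | inj₂ (inj₂ (s∈ω , y∈τ)) = inj₂ (inj₂ (there s∈ω , y∈τ))

-- The last letter of the pattern is its least one, so only the preceding ones, the stem, are recorded.
Begins : List ℕ → List ℕ → Set
Begins stem xs = ∃[ ω ] ∃[ y ] ∃[ ρ ] xs ≡ ω ++ y ∷ ρ × ω ≅ stem × All (y <_) ω

-- With ≼ read as ≥ the pattern avoided is 1-23, and with ≼ read as ≤ it is 1-32.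
module Avoidance
  {_≼_ : ℕ → ℕ → Set} (isDecTotalOrder : IsDecTotalOrder _≡_ _≼_)
  (≼-similar : ∀ {x x′ y y′} → Similar (x , y) (x′ , y′) → y ≼ y′ → x ≼ x′)
  where
  private
    O : DecTotalOrder 0ℓ 0ℓ 0ℓ
    O = record { isDecTotalOrder = isDecTotalOrder }
  open Sort O using (sort; sort-↭; sort-↗)

  -- Here x is a candidate for the first letter of an occurrence. `Linked` reflects that the other
  -- two letters are adjacent.
  Allows : ℕ → List ℕ → Set
  Allows x = Linked (λ y z → x < y → x < z → y ≼ z)

  Avoiding : List ℕ → Set
  Avoiding []       = ⊤
  Avoiding (x ∷ xs) = Allows x xs × Avoiding xs

  linked-++⁻ˡ : ∀ {R : ℕ → ℕ → Set} xs {ys} → Linked R (xs ++ ys) → Linked R xs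
  linked-++⁻ˡ []           _         = []
  linked-++⁻ˡ (_ ∷ [])     _         = [-]
  linked-++⁻ˡ (_ ∷ _ ∷ xs) (r ∷ rs) = r ∷ linked-++⁻ˡ (_ ∷ xs) rs

  avoiding-++⁻ˡ : ∀ xs {ys} → Avoiding (xs ++ ys) → Avoiding xs
  avoiding-++⁻ˡ []       _             = tt
  avoiding-++⁻ˡ (x ∷ xs) (allows , av) = linked-++⁻ˡ xs allows , avoiding-++⁻ˡ xs av

  allows-sorted : ∀ {x xs} → All (x <_) xs → Allows x xs → Linked _≼_ xs
  allows-sorted _                     []            = []
  allows-sorted _                     [-]           = [-]
  allows-sorted (x<y ∷ x<z ∷ x<xs) (y≼z ∷ rest) = y≼z x<y x<z ∷ allows-sorted (x<z ∷ x<xs) rest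

  avoiding-++⁻ʳ : ∀ xs {s ys} → All (s <_) ys → Avoiding (xs ++ s ∷ ys) → Linked _≼_ ys
  avoiding-++⁻ʳ []       s<ys (allows , _) = allows-sorted s<ys allows
  avoiding-++⁻ʳ (x ∷ xs) s<ys (_ , av)     = avoiding-++⁻ʳ xs s<ys av

  -- Neither adjacent pair containing s lies entirely above x, because s ≤ x; pairs within `ys` are
  -- in order outright.
  allows-++⁺ : ∀ {x xs s ys} → s ≤ x → Allows x xs → Linked _≼_ ys → Allows x (xs ++ s ∷ ys)
  allows-++⁺ {ys = []}     s≤x []             _   = [-]
  allows-++⁺ {ys = y ∷ ys} s≤x []             ys↗ =
    (λ x<s _ → contradiction s≤x (ℕ.<⇒≱ x<s)) ∷ Linked.map (λ y≼z _ _ → y≼z) ys↗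
  allows-++⁺ s≤x [-]            ys↗ = (λ _ x<s → contradiction s≤x (ℕ.<⇒≱ x<s)) ∷ allows-++⁺ s≤x [] ys↗
  allows-++⁺ s≤x (r ∷ rs)       ys↗ = r ∷ allows-++⁺ s≤x rs ys↗

  avoiding-++⁺ : ∀ {xs s ys} → All (s <_) xs → Avoiding xs → Linked _≼_ ys → Avoiding (xs ++ s ∷ ys)
  avoiding-++⁺ {[]}     []           tt            ys↗ = Linked.map (λ y≼z _ _ → y≼z) ys↗ , sorted-avoiding ys↗
    where
    sorted-avoiding : ∀ {ys} → Linked _≼_ ys → Avoiding ys
    sorted-avoiding {[]}     _   = tt
    sorted-avoiding {_ ∷ ys} ys↗ = Linked.map (λ y≼z _ _ → y≼z) (Linked.tail ys↗) , sorted-avoiding (Linked.tail ys↗)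
  avoiding-++⁺ {x ∷ xs} (s<x ∷ s<xs) (allows , av) ys↗ =
    allows-++⁺ (ℕ.<⇒≤ s<x) allows ys↗ , avoiding-++⁺ s<xs av ys↗

  ≅-avoiding : ∀ {xs ys} → xs ≅ ys → Avoiding ys → Avoiding xs
  ≅-avoiding (zs , refl , refl , similar) = go zs similar
    where
    allows : ∀ {z} zs → All (Similar z) zs → AllPairs Similar zs →
             Allows (proj₂ z) (List.map proj₂ zs) → Allows (proj₁ z) (List.map proj₁ zs)
    allows []           _                _                _        = []
    allows (_ ∷ [])     _                _                _        = [-]
    allows (u ∷ v ∷ zs) (zu ∷ zv ∷ zzs) ((uv ∷ _) ∷ s) (r ∷ rs) =
      (λ x<y x<z → ≼-similar uv (r (Equivalence.to (proj₁ zu) x<y) (Equivalence.to (proj₁ zv) x<z))) ∷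
      allows (v ∷ zs) (zv ∷ zzs) s rs
    go : ∀ zs → AllPairs Similar zs → Avoiding (List.map proj₂ zs) → Avoiding (List.map proj₁ zs)
    go []       _        _         = tt
    go (z ∷ zs) (zzs ∷ s) (a , av) = allows zs zzs s a , go zs s av

  module _ (stem : List ℕ) (stem! : Unique stem) (stem-avoiding : Avoiding stem)
           (c : ℕ → ℕ) (c-0 : c 0 ≡ 0)
           (c-suc : ∀ n → c (suc n) ≡ binomialTransform (λ j → c j ℕ.+ δ (length stem) j) n) where

    -- The alphabet `as` varies so that the induction can pass to the set of letters standing before
    -- the least one.
    Counted : List ℕ → List ℕ → Set
    Counted as xs = xs ↭ as × Avoiding xs × Begins stem xs

    -- The words that may stand before the least letter: either the pattern is already complete in
    -- them, or the least letter completes it.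
    Prefix : List ℕ → List ℕ → Set
    Prefix as xs = Counted as xs ⊎ (xs ↭ as × xs ≅ stem)

    prefix-disjoint : ∀ {as xs} → Counted as xs → ¬ (xs ↭ as × xs ≅ stem)
    prefix-disjoint (_ , _ , ω , y , ρ , refl , ω≅stem , _) (_ , xs≅stem) = ℕ.m+1+n≢m (length ω)
      (trans (sym (List.length-++ ω)) (trans (≅-length xs≅stem) (sym (≅-length ω≅stem))))

    assemble : ℕ → List ℕ × List ℕ → List ℕ
    assemble s (σ , bs) = σ ++ s ∷ sort bs

    Split : List ℕ → List ℕ × List ℕ → Set
    Split as (σ , bs) = ∃[ l ] Interleaving l bs as × Prefix l σ

    prefix-↭ : ∀ {as xs} → Prefix as xs → xs ↭ as
    prefix-↭ (inj₁ (xs↭as , _)) = xs↭as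
    prefix-↭ (inj₂ (xs↭as , _)) = xs↭as

    split-All : ∀ {P : ℕ → Set} {as σ bs} → Split as (σ , bs) → All P as → All P σ
    split-All (l , sp , pre) pas = ↭.All-resp-↭ (↭-sym (prefix-↭ pre)) (proj₁ (interleaving-All sp pas))

    assemble-injective : ∀ {s as z z′} → Increasing (s ∷ as) → Split as z → Split as z′ →
                         assemble s z ≡ assemble s z′ → z ≡ z′
    assemble-injective {s} {as} {σ , bs} {σ′ , bs′} (s<as ∷ as↗) split split′ eq
      with refl , sorts≡ ← ++-∷-injective (split-All split s<as) (split-All split′ s<as) eq
      -- Sorting forgets the order of `bs`, but as a subsequence of the increasing `as` it is the
      -- increasing arrangement of its letters.
      = cong (σ ,_) (increasing-↭⇒≡ (proj₂ (interleaving-AllPairs (proj₁ (proj₂ split)) as↗))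
                                     (proj₂ (interleaving-AllPairs (proj₁ (proj₂ split′)) as↗))
                                     (↭-trans (↭-sym (sort-↭ bs)) (↭-trans (↭-reflexive sorts≡) (sort-↭ bs′))))

    -- The letter y that completes the pattern cannot come after s: then s would belong to ω, giving
    -- y < s, whereas s is below all of τ.
    begins-prefix : ∀ {s σ τ} → All (s <_) τ → Begins stem (σ ++ s ∷ τ) → Begins stem σ ⊎ σ ≅ stem
    begins-prefix {s} {σ} {τ} s<τ (ω , y , ρ , eq , ω≅stem , y<ω) with ++-∷-compare σ ω eq
    ... | inj₁ (σ′ , σ≡)           = inj₁ (ω , y , σ′ , σ≡ , ω≅stem , y<ω)
    ... | inj₂ (inj₁ refl)         = inj₂ ω≅stem
    ... | inj₂ (inj₂ (s∈ω , y∈τ)) = contradiction (All.lookup y<ω s∈ω) (ℕ.<-asym (All.lookup s<τ y∈τ))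

    decompose : ∀ {s as xs} → All (s <_) as → Counted (s ∷ as) xs → ∃[ z ] Split as z × xs ≡ assemble s z
    decompose {s} {as} s<as (xs↭ , av , begins)
      with σ , τ , refl ← ∈.∈-∃++ (↭.∈-resp-↭ (↭-sym xs↭) (here refl))
      with l , r , sp , σ↭l , τ↭r ← ++-interleaving σ as (↭.drop-mid σ [] xs↭)
      = (σ , r) , (l , sp , prefix) ,
        cong (λ τ → σ ++ s ∷ τ) (sorted-↭⇒≡ isDecTotalOrder (avoiding-++⁻ʳ σ s<τ av) (sort-↗ r) (↭-trans τ↭r (↭-sym (sort-↭ r))))
      where
      s<τ : All (s <_) τ
      s<τ = ↭.All-resp-↭ (↭-sym τ↭r) (proj₂ (interleaving-All sp s<as))
      prefix : Prefix l σ
      prefix with begins-prefix s<τ begins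
      ... | inj₁ σ-begins = inj₁ (σ↭l , avoiding-++⁻ˡ σ av , σ-begins)
      ... | inj₂ σ≅stem   = inj₂ (σ↭l , σ≅stem)

    assemble-counted : ∀ {s as z} → All (s <_) as → Split as z → Counted (s ∷ as) (assemble s z)
    assemble-counted {s} {as} {σ , bs} s<as split@(l , sp , pre) =
      ↭-trans (↭.shift s σ (sort bs)) (↭-prep s (↭-trans (↭.++⁺ (prefix-↭ pre) (sort-↭ bs)) (↭-sym (toPermutation sp)))) ,
      avoiding-++⁺ s<σ (avoiding pre) (sort-↗ bs) ,
      begins pre
      where
      s<σ : All (s <_) σ
      s<σ = split-All split s<as
      avoiding : ∀ {l} → Prefix l σ → Avoiding σ
      avoiding (inj₁ (_ , av , _))   = av
      avoiding (inj₂ (_ , σ≅stem)) = ≅-avoiding σ≅stem stem-avoiding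
      begins : ∀ {l} → Prefix l σ → Begins stem (σ ++ s ∷ sort bs)
      begins (inj₁ (_ , _ , ω , y , ρ , refl , ω≅stem , y<ω)) =
        ω , y , ρ ++ s ∷ sort bs , List.++-assoc ω (y ∷ ρ) _ , ω≅stem , y<ω
      begins (inj₂ (_ , σ≅stem)) = σ , s , sort bs , refl , σ≅stem , s<σ

    -- Strong induction, with `m` bounding the length, since the recursive call concerns a sublist
    -- `l` of the tail. For `l` of length j there are `c j + δ (length stem) j` words before the
    -- least letter, and what follows that letter is forced; summing over `l` gives `c-suc`.
    size-counted : ∀ m {as} → length as ≤ m → Increasing as → HasSize (Counted as) (c (length as))
    size-counted m {[]} _ _ = subst (HasSize _) (sym c-0) (size-none none)
      where
      none : ∀ {xs} → ¬ Counted [] xs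
      none (xs↭[] , _ , ω , _ , _ , refl , _) with ω | ↭.↭-empty-inv xs↭[]
      ... | []    | ()
      ... | _ ∷ _ | ()
    size-counted (suc m) {s ∷ as} (ℕ.s≤s as≤m) s∷as↗@(s<as ∷ as↗) = subst (HasSize _) (sym (c-suc (length as)))
      (size-⇔ (λ { (z , split , refl) → assemble-counted s<as split }) (decompose s<as)
        (size-image (assemble s) (assemble-injective s∷as↗)
          (size-interleavings as Prefix (AllPairs.map ℕ.<⇒≢ as↗) λ {l} {r} sp →
            size-⊎ prefix-disjoint
              (size-counted m (ℕ.≤-trans (interleaving-length sp) as≤m) (proj₁ (interleaving-AllPairs sp as↗)))
              (size-≅ (proj₁ (interleaving-AllPairs sp as↗)) stem!))))
      where
      interleaving-length : ∀ {l r} → Interleaving l r as → length l ≤ length as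
      interleaving-length {l} {r} sp = subst (length l ≤_)
        (trans (sym (List.length-++ l)) (sym (↭.↭-length (toPermutation sp)))) (ℕ.m≤m+n (length l) (length r))

-- One-line notation and lists of letters

letters : ∀ {m n} → Vec (Fin m) n → List ℕ
letters v = List.map toℕ (toList v)

letters-injective : ∀ {m n} {u v : Vec (Fin m) n} → letters u ≡ letters v → u ≡ v
letters-injective {u = u} {v} eq = trans (sym (Vec.cast-is-id refl u))
  (Vec.toList-injective refl u v (List.map-injective Fin.toℕ-injective eq))

length-letters : ∀ {m n} (v : Vec (Fin m) n) → length (letters v) ≡ n
length-letters v = trans (List.length-map toℕ (toList v)) (Vec.length-toList v)

module _ {A : Set} {P : A → Set} where
  toList-All⁺ : ∀ {n} {v : Vec A n} → VecAll.All P v → All P (toList v)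
  toList-All⁺ []         = []
  toList-All⁺ (px ∷ pxs) = px ∷ toList-All⁺ pxs

  toList-All⁻ : ∀ {n} {v : Vec A n} → All P (toList v) → VecAll.All P v
  toList-All⁻ {v = []}    []         = []
  toList-All⁻ {v = _ ∷ _} (px ∷ pxs) = px ∷ toList-All⁻ pxs

module _ {A : Set} {R : A → A → Set} where
  toList-AllPairs⁺ : ∀ {n} {v : Vec A n} → VecAllPairs.AllPairs R v → AllPairs R (toList v)
  toList-AllPairs⁺ []         = []
  toList-AllPairs⁺ (px ∷ pxs) = toList-All⁺ px ∷ toList-AllPairs⁺ pxs

  toList-AllPairs⁻ : ∀ {n} {v : Vec A n} → AllPairs R (toList v) → VecAllPairs.AllPairs R v
  toList-AllPairs⁻ {v = []}    []         = []
  toList-AllPairs⁻ {v = _ ∷ _} (px ∷ pxs) = toList-All⁻ px ∷ toList-AllPairs⁻ pxs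

numerals : ℕ → List ℕ
numerals n = List.map toℕ (allFin n)

numerals-increasing : ∀ n → Increasing (numerals n)
numerals-increasing n = AllPairs.map⁺ (AllPairs.tabulate⁺-< (λ i<j → i<j))

length-numerals : ∀ n → length (numerals n) ≡ n
length-numerals n = trans (List.length-map toℕ (allFin n)) (List.length-tabulate {n = n} (λ i → i))

-- Pigeonhole: a missing letter put in front would give an injection from n + 1 positions into n
-- letters.
permutation-∈ : ∀ {n} {π : Vec (Fin n) n} → IsPermutation π → ∀ i → i ∈ toList π
permutation-∈ {n} {π} π! i with i ∈? toList π
  where open import Data.List.Membership.DecPropositional (Fin._≟_ {n}) using (_∈?_)
... | yes i∈π = i∈π
... | no  i∉π = contradiction
  (Fin.injective⇒≤ {f = lookup (i ∷ π)} (VecUnique.lookup-injective iπ! _ _))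
  ℕ.1+n≰n
  where
  iπ! : VecUnique.Unique (i ∷ π)
  iπ! = toList-All⁻ (All.tabulate λ { j∈π refl → i∉π j∈π }) ∷ π!

permutation-↭ : ∀ {n} {π : Vec (Fin n) n} → IsPermutation π → letters π ↭ numerals n
permutation-↭ {n} {π} π! = ↭.map⁺ toℕ (∼bag⇒↭ (∈.unique∧set⇒bag (toList-AllPairs⁺ π!) (Unique.allFin⁺ n)
  (λ {i} → mk⇔ (λ _ → ∈.∈-allFin i) (λ _ → permutation-∈ π! i))))

letters-unique : ∀ {m n} {v : Vec (Fin m) n} → VecUnique.Unique v → Unique (letters v)
letters-unique v! = Unique.map⁺ Fin.toℕ-injective (toList-AllPairs⁺ v!)

↭-permutation : ∀ {n xs} → xs ↭ numerals n → ∃[ π ] IsPermutation {n} π × letters π ≡ xs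
↭-permutation {n} {xs} xs↭ with ys , refl , fins↭ys ← ↭.↭-map-inv toℕ (↭-sym xs↭) =
  π , toList-AllPairs⁻ (subst Unique (sym toList-π) (Unique-resp-↭ fins↭ys (Unique.allFin⁺ n))) ,
  cong (List.map toℕ) toList-π
  where
  ys-length : length ys ≡ n
  ys-length = trans (sym (↭.↭-length fins↭ys)) (List.length-tabulate {n = n} (λ i → i))
  π : Vec (Fin n) n
  π = Vec.cast ys-length (Vec.fromList ys)
  toList-π : toList π ≡ ys
  toList-π = trans (Vec.toList-cast ys-length (Vec.fromList ys)) (Vec.toList∘fromList ys)

-- Order-isomorphism of vectors and of lists

pairs : ∀ {m n l} → Vec (Fin m) l → Vec (Fin n) l → List (ℕ × ℕ)
pairs []      []      = []
pairs (x ∷ u) (y ∷ v) = (toℕ x , toℕ y) ∷ pairs u v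

proj₁-pairs : ∀ {m n l} (u : Vec (Fin m) l) (v : Vec (Fin n) l) → List.map proj₁ (pairs u v) ≡ letters u
proj₁-pairs []      []      = refl
proj₁-pairs (x ∷ u) (y ∷ v) = cong (toℕ x ∷_) (proj₁-pairs u v)

proj₂-pairs : ∀ {m n l} (u : Vec (Fin m) l) (v : Vec (Fin n) l) → List.map proj₂ (pairs u v) ≡ letters v
proj₂-pairs []      []      = refl
proj₂-pairs (x ∷ u) (y ∷ v) = cong (toℕ y ∷_) (proj₂-pairs u v)

module _ {P : ℕ × ℕ → Set} where
  pairs-All⁺ : ∀ {m n l} {u : Vec (Fin m) l} {v : Vec (Fin n) l} →
               (∀ i → P (toℕ (lookup u i) , toℕ (lookup v i))) → All P (pairs u v)
  pairs-All⁺ {u = []}    {[]}    p = []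
  pairs-All⁺ {u = _ ∷ _} {_ ∷ _} p = p zero ∷ pairs-All⁺ (p ∘ suc)

  pairs-All⁻ : ∀ {m n l} {u : Vec (Fin m) l} {v : Vec (Fin n) l} →
               All P (pairs u v) → ∀ i → P (toℕ (lookup u i) , toℕ (lookup v i))
  pairs-All⁻ {u = _ ∷ _} {_ ∷ _} (p ∷ _)  zero    = p
  pairs-All⁻ {u = _ ∷ _} {_ ∷ _} (_ ∷ ps) (suc i) = pairs-All⁻ ps i

orderIsomorphic⇒similar : ∀ {m n l} {u : Vec (Fin m) l} {v : Vec (Fin n) l} →
                          OrderIsomorphic u v → AllPairs Similar (pairs u v)
orderIsomorphic⇒similar {u = []}    {[]}    iso = []
orderIsomorphic⇒similar {u = _ ∷ u} {_ ∷ v} iso =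
  pairs-All⁺ {u = u} {v} (λ i → iso zero (suc i) , iso (suc i) zero) ∷
  orderIsomorphic⇒similar {u = u} {v} (λ i j → iso (suc i) (suc j))

similar⇒orderIsomorphic : ∀ {m n l} {u : Vec (Fin m) l} {v : Vec (Fin n) l} →
                          AllPairs Similar (pairs u v) → OrderIsomorphic u v
similar⇒orderIsomorphic {u = x ∷ u} {y ∷ v} (_ ∷ _)  zero    zero    =
  mk⇔ (λ x<x → contradiction x<x (ℕ.<-irrefl refl)) (λ y<y → contradiction y<y (ℕ.<-irrefl refl))
similar⇒orderIsomorphic {u = x ∷ u} {y ∷ v} (s ∷ _)  zero    (suc j) = proj₁ (pairs-All⁻ {u = u} {v} s j)
similar⇒orderIsomorphic {u = x ∷ u} {y ∷ v} (s ∷ _)  (suc i) zero    = proj₂ (pairs-All⁻ {u = u} {v} s i)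
similar⇒orderIsomorphic {u = x ∷ u} {y ∷ v} (_ ∷ ss) (suc i) (suc j) = similar⇒orderIsomorphic {u = u} {v} ss i j

orderIsomorphic⇒≅ : ∀ {m n l} (u : Vec (Fin m) l) (v : Vec (Fin n) l) → OrderIsomorphic u v → letters u ≅ letters v
orderIsomorphic⇒≅ u v iso = pairs u v , proj₁-pairs u v , proj₂-pairs u v , orderIsomorphic⇒similar {u = u} {v} iso

≅⇒orderIsomorphic : ∀ {m n l} (u : Vec (Fin m) l) (v : Vec (Fin n) l) → letters u ≅ letters v → OrderIsomorphic u v
≅⇒orderIsomorphic u v (zs , eq₁ , eq₂ , similar) = similar⇒orderIsomorphic {u = u} {v} (subst (AllPairs Similar)
  (map-proj-injective (trans eq₁ (sym (proj₁-pairs u v))) (trans eq₂ (sym (proj₂-pairs u v)))) similar)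

letters-truncate : ∀ {m k n} (k≤n : k ≤ n) (v : Vec (Fin m) n) → letters (truncate k≤n v) ≡ List.take k (letters v)
letters-truncate z≤n       v       = refl
letters-truncate (s≤s k≤n) (x ∷ v) = cong (toℕ x ∷_) (letters-truncate k≤n v)

map-∷ʳ⁻ : ∀ {A B : Set} (f : A → B) zs {ys y} → List.map f zs ≡ ys List.∷ʳ y →
          ∃[ us ] ∃[ u ] zs ≡ us List.∷ʳ u × List.map f us ≡ ys × f u ≡ y
map-∷ʳ⁻ f zs {ys} eq with List.initLast zs
... | List.InitLast.[] = contradiction (List.++-conicalʳ ys _ (sym eq)) λ ()
... | us List.∷ʳ′ u = us , u , refl , List.∷ʳ-injective _ ys (trans (sym (List.map-++ f us _)) eq)

AllPairs-∷ʳ⁻ : ∀ {A : Set} {R : A → A → Set} us {u} → AllPairs R (us List.∷ʳ u) → AllPairs R us × All (λ x → R x u) us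
AllPairs-∷ʳ⁻ []       _          = [] , []
AllPairs-∷ʳ⁻ (x ∷ us) (xs ∷ rs) =
  let xus , xu = All.∷ʳ⁻ xs ; rus , ru = AllPairs-∷ʳ⁻ us rs in xus ∷ rus , xu ∷ ru

take-suc-length : ∀ {A : Set} (ω : List A) {y ρ} → List.take (suc (length ω)) (ω ++ y ∷ ρ) ≡ ω List.∷ʳ y
take-suc-length []       = refl
take-suc-length (x ∷ ω) = cong (x ∷_) (take-suc-length ω)

module _ {stem : List ℕ} (0<stem : All (0 <_) stem) where

  -- The letter of `xs` paired with the final 0 is the y of `Begins`. It is below the letters before
  -- it because 0 is below the stem.
  take-≅⇒begins : ∀ xs → List.take (suc (length stem)) xs ≅ (stem List.∷ʳ 0) → Begins stem xs
  take-≅⇒begins xs (zs , eq₁ , eq₂ , similar) with us , u , refl , refl , u₂≡0 ← map-∷ʳ⁻ proj₂ zs eq₂ =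
    List.map proj₁ us , proj₁ u , _ ,
    trans (sym (List.take++drop≡id (suc (length stem)) xs))
      (trans (cong (_++ List.drop (suc (length stem)) xs) (trans (sym eq₁) (List.map-++ proj₁ us _))) (List.++-assoc (List.map proj₁ us) _ _)) ,
    (us , refl , refl , proj₁ (AllPairs-∷ʳ⁻ us similar)) ,
    All.map⁺ (All.zipWith (λ ((_ , u<z) , 0<z) → Equivalence.from u<z (subst (_< _) (sym u₂≡0) 0<z))
      (proj₂ (AllPairs-∷ʳ⁻ us similar) , All.map⁻ 0<stem))

  begins⇒take-≅ : ∀ {xs} → Begins stem xs → List.take (suc (length stem)) xs ≅ (stem List.∷ʳ 0)
  begins⇒take-≅ (ω , y , ρ , refl , ω≅stem@(us , refl , refl , similar) , y<ω)
    rewrite sym (≅-length ω≅stem) =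
    us List.∷ʳ (y , 0) ,
    trans (List.map-++ proj₁ us _) (sym (take-suc-length (List.map proj₁ us))) ,
    List.map-++ proj₂ us _ ,
    AllPairs.++⁺ similar ([] ∷ []) (All.zipWith descent (All.map⁻ y<ω , All.map⁻ 0<stem))
    where
    descent : ∀ {z} → y < proj₁ z × 0 < proj₂ z → All (Similar z) ((y , 0) ∷ [])
    descent (y<x , 0<b) = (mk⇔ (λ x<y → contradiction x<y (ℕ.<-asym y<x)) (λ ()) , mk⇔ (λ _ → 0<b) (λ _ → y<x)) ∷ []

  begins-length : ∀ {xs} → Begins stem xs → suc (length stem) ≤ length xs
  begins-length (ω , y , ρ , refl , ω≅stem , _) = subst (_ ≤_) (sym (List.length-++ ω))
    (subst (λ l → suc l ≤ length ω ℕ.+ suc (length ρ)) (≅-length ω≅stem)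
      (subst (suc (length ω) ≤_) (sym (ℕ.+-suc (length ω) (length ρ))) (s≤s (ℕ.m≤m+n (length ω) (length ρ)))))

-- The second argument bounds the depth of the recursion.
boundedCount : ℕ → ℕ → ℕ → ℕ
boundedCount d zero    n       = 0
boundedCount d (suc m) zero    = 0
boundedCount d (suc m) (suc n) = binomialTransform (λ j → boundedCount d m j ℕ.+ δ d j) n

binomialTransform-cong : ∀ n {f g} → (∀ {j} → j ≤ n → f j ≡ g j) → binomialTransform f n ≡ binomialTransform g n
binomialTransform-cong zero    f≗g = f≗g z≤n
binomialTransform-cong (suc n) f≗g = cong₂ ℕ._+_
  (binomialTransform-cong n (λ j≤n → f≗g (ℕ.m≤n⇒m≤1+n j≤n))) (binomialTransform-cong n (f≗g ∘ s≤s))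

boundedCount-stable : ∀ d m m′ {n} → n ≤ m → n ≤ m′ → boundedCount d m n ≡ boundedCount d m′ n
boundedCount-stable d zero    zero     z≤n       z≤n        = refl
boundedCount-stable d zero    (suc m′) z≤n       z≤n        = refl
boundedCount-stable d (suc m) zero     z≤n       z≤n        = refl
boundedCount-stable d (suc m) (suc m′) z≤n       z≤n        = refl
boundedCount-stable d (suc m) (suc m′) (s≤s n≤m) (s≤s n≤m′) = binomialTransform-cong _ λ {j} j≤n →
  cong (ℕ._+ δ d j) (boundedCount-stable d m m′ (ℕ.≤-trans j≤n n≤m) (ℕ.≤-trans j≤n n≤m′))

-- The count for a pattern of length d + 1 without the convention on the empty permutation: its
-- value at 0 is 0 for every d.
wordCount : ℕ → ℕ → ℕ
wordCount d n = boundedCount d n n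

wordCount-suc : ∀ d n → wordCount d (suc n) ≡ binomialTransform (λ j → wordCount d j ℕ.+ δ d j) n
wordCount-suc d n = binomialTransform-cong n λ {j} j≤n → cong (ℕ._+ δ d j) (boundedCount-stable d n j j≤n ℕ.≤-refl)

words-unique : ∀ m n → Unique (words m n)
words-unique m zero    = [] ∷ []
words-unique m (suc n) = Unique.cartesianProductWith⁺ _∷_ Vec.∷-injective (Unique.allFin⁺ m) (words-unique m n)

words-complete : ∀ {m n} (v : Vec (Fin m) n) → v ∈ words m n
words-complete []      = here refl
words-complete (x ∷ v) = ∈.∈-cartesianProductWith⁺ _∷_ (∈.∈-allFin x) (words-complete v)

-- The numbers N and complementation

Admissible : ∀ {k n} → Vec (Fin k) k → Vec (Fin 3) 3 → Vec (Fin n) n → Set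
Admissible p q π = IsPermutation π × π Avoids q × π BeginsWith p

size-N : ∀ {k} (p : Vec (Fin k) k) q n → HasSize (Admissible {n = n} p q) (N p q n)
size-N p q n = record
  { elements = List.filter admissible? (words n n)
  ; unique   = Unique.filter⁺ admissible? (words-unique n n)
  ; sound    = λ π∈ → proj₂ (∈.∈-filter⁻ admissible? {xs = words n n} π∈)
  ; complete = λ adm → ∈.∈-filter⁺ admissible? (words-complete _) adm
  ; size     = refl
  }
  where admissible? = λ π → isPermutation? π ×-dec ¬? (contains? π q) ×-dec beginsWith? π p

opposite-< : ∀ {n} {i j : Fin n} → i Fin.< j → opposite j Fin.< opposite i
opposite-< {n} {i} {j} i<j = subst₂ _<_ (sym (Fin.opposite-prop j)) (sym (Fin.opposite-prop i))
  (ℕ.∸-monoʳ-< (s≤s i<j) (Fin.toℕ<n j))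

opposite-<-⇔ : ∀ {n} {i j : Fin n} → opposite i Fin.< opposite j ⇔ j Fin.< i
opposite-<-⇔ = mk⇔ (λ lt → subst₂ Fin._<_ (Fin.opposite-involutive _) (Fin.opposite-involutive _) (opposite-< lt)) opposite-<

orderIsomorphic-opposite : ∀ {m n l} (u : Vec (Fin m) l) (v : Vec (Fin n) l) → OrderIsomorphic u v →
                           OrderIsomorphic (Vec.map opposite u) (Vec.map opposite v)
orderIsomorphic-opposite u v iso i j
  rewrite Vec.lookup-map i opposite u | Vec.lookup-map j opposite u
        | Vec.lookup-map i opposite v | Vec.lookup-map j opposite v =
  mk⇔ (Equivalence.from opposite-<-⇔ ∘ Equivalence.to (iso j i) ∘ Equivalence.to opposite-<-⇔)
      (Equivalence.from opposite-<-⇔ ∘ Equivalence.from (iso j i) ∘ Equivalence.to opposite-<-⇔)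

complement-involutive : ∀ {n} (π : Vec (Fin n) n) → complement (complement π) ≡ π
complement-involutive π = trans (sym (Vec.map-∘ opposite opposite π))
  (trans (Vec.map-cong Fin.opposite-involutive π) (Vec.map-id π))

complement-contains : ∀ {n} (π : Vec (Fin n) n) q → π Contains q → complement π Contains complement q
complement-contains π q (i , j , j⁺ , i<j , adj , iso) = i , j , j⁺ , i<j , adj ,
  subst (λ v → OrderIsomorphic v (complement q)) same
    (orderIsomorphic-opposite (lookup π i ∷ lookup π j ∷ lookup π j⁺ ∷ []) q iso)
  where
  same : Vec.map opposite (lookup π i ∷ lookup π j ∷ lookup π j⁺ ∷ []) ≡
         lookup (complement π) i ∷ lookup (complement π) j ∷ lookup (complement π) j⁺ ∷ []
  same rewrite Vec.lookup-map i opposite π | Vec.lookup-map j opposite π | Vec.lookup-map j⁺ opposite π = refl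

complement-avoids : ∀ {n} (π : Vec (Fin n) n) q → π Avoids q → complement π Avoids complement q
complement-avoids π q avoids contains = avoids
  (subst₂ _Contains_ (complement-involutive π) (complement-involutive q) (complement-contains (complement π) (complement q) contains))

truncate-map : ∀ {A B : Set} {m n} (f : A → B) (m≤n : m ≤ n) (v : Vec A n) →
               truncate m≤n (Vec.map f v) ≡ Vec.map f (truncate m≤n v)
truncate-map f z≤n       v       = refl
truncate-map f (s≤s m≤n) (x ∷ v) = cong (f x ∷_) (truncate-map f m≤n v)

complement-admissible : ∀ {k n} (p : Vec (Fin k) k) q (π : Vec (Fin n) n) → Admissible p q π →
                        Admissible (complement p) (complement q) (complement π)
complement-admissible p q π (π! , avoids , begins) =
  VecUnique.map⁺ opposite-injective π! , complement-avoids π q avoids , complement-begins begins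
  where
  opposite-injective : ∀ {n} {i j : Fin n} → opposite i ≡ opposite j → i ≡ j
  opposite-injective {i = i} {j} eq =
    trans (sym (Fin.opposite-involutive i)) (trans (cong opposite eq) (Fin.opposite-involutive j))
  complement-begins : π BeginsWith p → complement π BeginsWith complement p
  complement-begins (inj₁ (k≤n , iso)) = inj₁ (k≤n ,
    subst (λ v → OrderIsomorphic v (complement p)) (sym (truncate-map opposite k≤n π)) (orderIsomorphic-opposite (truncate k≤n π) p iso))
  complement-begins (inj₂ empty) = inj₂ empty

N-complement : ∀ {k} (p : Vec (Fin k) k) q n → N (complement p) (complement q) n ≡ N p q n
N-complement p q n = size-unique (size-N (complement p) (complement q) n)
  (size-⇔ (λ { (π , adm , refl) → complement-admissible p q π adm })
          (λ {π} adm → complement π ,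
             subst₂ (λ p q → Admissible p q (complement π)) (complement-involutive p) (complement-involutive q)
               (complement-admissible (complement p) (complement q) π adm) ,
             sym (complement-involutive π))
    (size-image complement (λ {π} {π′} _ _ eq →
        trans (sym (complement-involutive π)) (trans (cong complement eq) (complement-involutive π′)))
      (size-N p q n)))

last-complement : ∀ {n} (p : Vec (Fin (suc n)) (suc n)) → Vec.last p ≡ zero → Vec.last (complement p) ≡ fromℕ n
last-complement p last≡0 with ps , x , refl ← Vec.initLast p =
  trans (cong Vec.last (Vec.map-∷ʳ opposite x ps)) (trans (Vec.last-∷ʳ (opposite x) (Vec.map opposite ps))
    (cong opposite last≡0))

-- The hypothesis `matches` ties the vector `q` to the order ≼: an occurrence is a letter below both
-- members of a later adjacent pair that violates ≼.
module Counting
  {_≼_ : ℕ → ℕ → Set} (isDecTotalOrder : IsDecTotalOrder _≡_ _≼_)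
  (≼-similar : ∀ {x x′ y y′} → Similar (x , y) (x′ , y′) → y ≼ y′ → x ≼ x′)
  (q : Vec (Fin 3) 3)
  (matches : ∀ {n} {x y z : Fin n} → OrderIsomorphic (x ∷ y ∷ z ∷ []) q ⇔
             (toℕ x < toℕ y × toℕ x < toℕ z × ¬ toℕ y ≼ toℕ z))
  where
  open Avoidance isDecTotalOrder ≼-similar
  open IsDecTotalOrder isDecTotalOrder using () renaming (_≤?_ to _≼?_)

  allows⇒≼ : ∀ {m n x} {v : Vec (Fin m) n} → Allows x (letters v) → ∀ j j⁺ → toℕ j⁺ ≡ suc (toℕ j) →
             x < toℕ (lookup v j) → x < toℕ (lookup v j⁺) → toℕ (lookup v j) ≼ toℕ (lookup v j⁺)
  allows⇒≼ {v = _ ∷ _ ∷ _} (r ∷ _)  zero    (suc zero)       _   = r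
  allows⇒≼ {v = _ ∷ _ ∷ _} (_ ∷ rs) (suc j) (suc j⁺)         adj = allows⇒≼ rs j j⁺ (ℕ.suc-injective adj)
  allows⇒≼ {v = _ ∷ []}    _        zero    zero             ()

  ≼⇒allows : ∀ {m n x} {v : Vec (Fin m) n} →
             (∀ j j⁺ → toℕ j⁺ ≡ suc (toℕ j) → x < toℕ (lookup v j) → x < toℕ (lookup v j⁺) →
               toℕ (lookup v j) ≼ toℕ (lookup v j⁺)) → Allows x (letters v)
  ≼⇒allows {v = []}        r = []
  ≼⇒allows {v = _ ∷ []}    r = [-]
  ≼⇒allows {v = _ ∷ _ ∷ _} r =
    r zero (suc zero) refl ∷ ≼⇒allows (λ j j⁺ adj → r (suc j) (suc j⁺) (cong suc adj))

  Ordered : ∀ {m n} → Vec (Fin m) n → Set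
  Ordered v = ∀ i j j⁺ → i Fin.< j → toℕ j⁺ ≡ suc (toℕ j) →
    toℕ (lookup v i) < toℕ (lookup v j) → toℕ (lookup v i) < toℕ (lookup v j⁺) →
    toℕ (lookup v j) ≼ toℕ (lookup v j⁺)

  avoiding⇒ordered : ∀ {m n} {v : Vec (Fin m) n} → Avoiding (letters v) → Ordered v
  avoiding⇒ordered {v = _ ∷ _} (allows , _) zero    (suc j) (suc j⁺) _         adj = allows⇒≼ allows j j⁺ (ℕ.suc-injective adj)
  avoiding⇒ordered {v = _ ∷ _} (_ , av)     (suc i) (suc j) (suc j⁺) (s≤s i<j) adj = avoiding⇒ordered av i j j⁺ i<j (ℕ.suc-injective adj)

  ordered⇒avoiding : ∀ {m n} {v : Vec (Fin m) n} → Ordered v → Avoiding (letters v)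
  ordered⇒avoiding {v = []}    _   = tt
  ordered⇒avoiding {v = _ ∷ _} ord =
    ≼⇒allows (λ j j⁺ adj → ord zero (suc j) (suc j⁺) (s≤s z≤n) (cong suc adj)) ,
    ordered⇒avoiding (λ i j j⁺ i<j adj → ord (suc i) (suc j) (suc j⁺) (s≤s i<j) (cong suc adj))

  avoids⇒avoiding : ∀ {n} {π : Vec (Fin n) n} → π Avoids q → Avoiding (letters π)
  -- Avoidance is a negation, while `Ordered` asserts ≼ positively; decidability of ≼ bridges the
  -- two.
  avoids⇒avoiding avoids = ordered⇒avoiding λ i j j⁺ i<j adj x<y x<z → decidable-stable (_ ≼? _)
    λ y⋠z → avoids (i , j , j⁺ , i<j , adj , Equivalence.from matches (x<y , x<z , y⋠z))

  avoiding⇒avoids : ∀ {n} {π : Vec (Fin n) n} → Avoiding (letters π) → π Avoids q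
  avoiding⇒avoids av (i , j , j⁺ , i<j , adj , iso) =
    let x<y , x<z , y⋠z = Equivalence.to matches iso in y⋠z (avoiding⇒ordered av i j j⁺ i<j adj x<y x<z)

  -- `letters` carries the admissible permutations bijectively onto the words counted over the
  -- alphabet 0, ..., n, with the letters of `ps` as stem.
  N-∷ʳ : ∀ {d} (ps : Vec (Fin (suc d)) d) → IsPermutation (ps Vec.∷ʳ zero) → (ps Vec.∷ʳ zero) Avoids q →
         ∀ n → N (ps Vec.∷ʳ zero) q (suc n) ≡ wordCount d (suc n)
  N-∷ʳ {d} ps p! p-avoids n = size-unique {P = Listed}
      (size-⇔ {Q = Listed} to from (size-image letters (λ _ _ → letters-injective) (size-N (ps Vec.∷ʳ zero) q (suc n))))
      (subst (HasSize Listed) (cong (wordCount d) (length-numerals (suc n)))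
        (size-counted stem stem! stem-avoiding (wordCount d) refl wordCount-rec
          (length (numerals (suc n))) ℕ.≤-refl (numerals-increasing (suc n))))
    where
    stem : List ℕ
    stem = letters ps
    letters-p : letters (ps Vec.∷ʳ zero) ≡ stem List.∷ʳ 0
    letters-p = trans (cong (List.map toℕ) (Vec.toList-∷ʳ zero ps)) (List.map-++ toℕ (toList ps) _)
    p-unique : Unique (stem List.∷ʳ 0)
    p-unique = subst Unique letters-p (letters-unique p!)
    Listed : List ℕ → Set
    Listed xs = xs ↭ numerals (suc n) × Avoiding xs × Begins stem xs
    stem! : Unique stem
    stem! = proj₁ (AllPairs-∷ʳ⁻ stem p-unique)
    0<stem : All (0 <_) stem
    0<stem = All.map ℕ.n≢0⇒n>0 (proj₂ (AllPairs-∷ʳ⁻ stem p-unique))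
    stem-avoiding : Avoiding stem
    stem-avoiding = avoiding-++⁻ˡ stem (subst Avoiding letters-p (avoids⇒avoiding p-avoids))
    wordCount-rec : ∀ n → wordCount d (suc n) ≡ binomialTransform (λ j → wordCount d j ℕ.+ δ (length stem) j) n
    wordCount-rec n rewrite length-letters ps = wordCount-suc d n
    to : ∀ {xs} → ∃[ π ] Admissible {n = suc n} (ps Vec.∷ʳ zero) q π × xs ≡ letters π →
         Listed xs
    -- The convention on the empty permutation cannot apply at the positive length n + 1, so only
    -- `inj₁` remains.
    to (π , (π! , avoids , inj₁ (k≤n , iso)) , refl) =
      permutation-↭ π! , avoids⇒avoiding avoids ,
      take-≅⇒begins 0<stem (letters π) (subst (λ l → List.take (suc l) (letters π) ≅ (stem List.∷ʳ 0)) (sym (length-letters ps))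
        (subst₂ _≅_ (letters-truncate k≤n π) letters-p (orderIsomorphic⇒≅ _ _ iso)))
    from : ∀ {xs} → Listed xs →
           ∃[ π ] Admissible {n = suc n} (ps Vec.∷ʳ zero) q π × xs ≡ letters π
    from (xs↭ , av , begins) with π , π! , refl ← ↭-permutation xs↭ =
      π , (π! , avoiding⇒avoids av , inj₁ (k≤n , ≅⇒orderIsomorphic _ _
        (subst₂ _≅_ (sym (letters-truncate k≤n π)) (sym letters-p)
          (subst (λ l → List.take (suc l) (letters π) ≅ (stem List.∷ʳ 0)) (length-letters ps) (begins⇒take-≅ 0<stem begins))))) , refl
      where
      k≤n : suc d ≤ suc n
      k≤n = subst₂ _≤_ (cong suc (length-letters ps)) (length-letters π) (begins-length 0<stem begins)

  N-suc : ∀ {d} (p : Vec (Fin (suc d)) (suc d)) → IsPermutation p → Vec.last p ≡ zero → p Avoids q →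
          ∀ n → N p q (suc n) ≡ wordCount d (suc n)
  N-suc p p! last≡0 p-avoids n = subst (λ p → N p q (suc n) ≡ wordCount _ (suc n)) (sym p≡)
    (N-∷ʳ ps (subst IsPermutation p≡ p!) (subst (_Avoids q) p≡ p-avoids) n)
    where
    ps = Vec.init p
    p≡ : p ≡ ps Vec.∷ʳ zero
    p≡ = trans (proj₂ (proj₂ (Vec.initLast p))) (cong (ps Vec.∷ʳ_) last≡0)

module Counting₁₂₃ = Counting (Flip.isDecTotalOrder ℕ.≤-isDecTotalOrder)
  -- By contraposition: the negation of ≼ is a strict inequality, which `Similar` transports.
  (λ (p , _) y′≤y → ℕ.≮⇒≥ λ x<x′ → ℕ.<⇒≱ (Equivalence.to p x<x′) y′≤y)
  1-23
  (λ {_} {x} {y} {z} → mk⇔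
    (λ iso → Equivalence.from (iso 0F 1F) (s≤s z≤n) , Equivalence.from (iso 0F 2F) (s≤s z≤n) ,
             ℕ.<⇒≱ (Equivalence.from (iso 1F 2F) (s≤s (s≤s z≤n))))
    (λ (x<y , x<z , z≰y) → similar⇒orderIsomorphic {u = x ∷ y ∷ z ∷ []} {v = 1-23}
      ((similar-< x<y (s≤s z≤n) ∷ similar-< x<z (s≤s z≤n) ∷ []) ∷
       (similar-< (ℕ.≰⇒> z≰y) (s≤s (s≤s z≤n)) ∷ []) ∷ [] ∷ [])))

module Counting₁₃₂ = Counting ℕ.≤-isDecTotalOrder
  (λ (_ , p) y≤y′ → ℕ.≮⇒≥ λ x′<x → ℕ.<⇒≱ (Equivalence.to p x′<x) y≤y′)
  1-32
  (λ {_} {x} {y} {z} → mk⇔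
    (λ iso → Equivalence.from (iso 0F 1F) (s≤s z≤n) , Equivalence.from (iso 0F 2F) (s≤s z≤n) ,
             ℕ.<⇒≱ (Equivalence.from (iso 2F 1F) (s≤s (s≤s z≤n))))
    (λ (x<y , x<z , y≰z) → similar⇒orderIsomorphic {u = x ∷ y ∷ z ∷ []} {v = 1-32}
      ((similar-< x<y (s≤s z≤n) ∷ similar-< x<z (s≤s z≤n) ∷ []) ∷
       -- In 1-32 the adjacent letters descend, so the increasing comparison is made from z to y and
       -- then reversed.
       (Similar-sym {toℕ z , 1} {toℕ y , 2} (similar-< (ℕ.≰⇒> y≰z) (s≤s (s≤s z≤n))) ∷ []) ∷ [] ∷ [])))

-- From the counting recurrence to the closed form

module _ {c ℓ} (K : ExponentialℚAlgebra c ℓ) where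
  open PowerSeries K using (_≋_; closedForm; E)
  open SeriesProperties K using (egf-closedForm₁; egf-closedForm₂)

  -- The value of `N` at 0 is found by evaluating the filter on the empty word. For k = 1 it is 1,
  -- so `N` equals `wordCount 0` plus `δ 0` everywhere: the inhomogeneous term is absorbed and the
  -- recurrence becomes N(n+1) = Σⱼ C(n,j) N(j). For k ≥ 2 it is 0, `N` agrees with `wordCount`, and
  -- the δ term remains.
  E-closedForm : ∀ d (p : Vec (Fin (suc d)) (suc d)) q → (∀ n → N p q (suc n) ≡ wordCount d (suc n)) →
                 E p q ≋ closedForm (suc d)
  E-closedForm zero p q N-suc = egf-closedForm₁ {N p q} refl λ n →
    trans (N-suc n) (trans (wordCount-suc 0 n) (binomialTransform-cong n λ {j} _ → sym (N≡ j)))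
    where
    N≡ : ∀ n → N p q n ≡ wordCount 0 n ℕ.+ δ 0 n
    N≡ zero    = refl
    N≡ (suc n) = trans (N-suc n) (sym (ℕ.+-identityʳ _))
  E-closedForm (suc d) p q N-suc = egf-closedForm₂ d {N p q} refl λ n →
    trans (N-suc n) (trans (wordCount-suc (suc d) n)
      (binomialTransform-cong n λ {j} _ → cong (ℕ._+ δ (suc d) j) (sym (N≡ j))))
    where
    N≡ : ∀ n → N p q n ≡ wordCount (suc d) n
    N≡ zero    = refl
    N≡ (suc n) = N-suc n

theorem28 : ∀ {c ℓ} (K : ExponentialℚAlgebra c ℓ) (k-1 : ℕ) →
    let k = suc k-1
        open PowerSeries K
    in
    (p₁ p₂ : Vec (Fin k) k) →
    IsPermutation p₁ → IsPermutation p₂ →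
    last p₁ ≡ zero → last p₂ ≡ zero →
    p₁ Avoids 1-23 → p₂ Avoids 1-32 →
    (last (complement p₁) ≡ fromℕ k-1 × last (complement p₂) ≡ fromℕ k-1 ×
     complement p₁ Avoids 3-21 × complement p₂ Avoids 3-12) ×
    (E p₁ 1-23 ≋ E (complement p₁) 3-21 ×
     E (complement p₁) 3-21 ≋ E p₂ 1-32 ×
     E p₂ 1-32 ≋ E (complement p₂) 3-12 ×
     E (complement p₂) 3-12 ≋ closedForm k)
theorem28 K d p₁ p₂ p₁! p₂! last₁ last₂ avoids₁ avoids₂ =
  (last-complement p₁ last₁ , last-complement p₂ last₂ ,
   complement-avoids p₁ 1-23 avoids₁ , complement-avoids p₂ 1-32 avoids₂) ,
  E₁ ,
  -- The permutations p₁ and p₂ are related only through the closed form, which depends on k alone.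
  (λ n → K.trans (K.sym (E₁ n)) (K.trans (closed₁ n) (K.sym (closed₂ n)))) ,
  E₂ ,
  (λ n → K.trans (K.sym (E₂ n)) (closed₂ n))
  where
  module K = ExponentialℚAlgebra K
  open PowerSeries K
  E-complement : ∀ (p : Vec (Fin (suc d)) (suc d)) q {q′} → complement q ≡ q′ → E p q ≋ E (complement p) q′
  E-complement p q refl = SeriesProperties.egf-cong K (λ n → sym (N-complement p q n))
  E₁ : E p₁ 1-23 ≋ E (complement p₁) 3-21
  E₁ = E-complement p₁ 1-23 {3-21} refl
  E₂ : E p₂ 1-32 ≋ E (complement p₂) 3-12
  E₂ = E-complement p₂ 1-32 {3-12} refl
  closed₁ : E p₁ 1-23 ≋ closedForm (suc d)
  closed₁ = E-closedForm K d p₁ 1-23 (Counting₁₂₃.N-suc p₁ p₁! last₁ avoids₁)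
  closed₂ : E p₂ 1-32 ≋ closedForm (suc d)
  closed₂ = E-closedForm K d p₂ 1-32 (Counting₁₃₂.N-suc p₂ p₂! last₂ avoids₂)
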